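{- The class of all (finite) graphs with no $K_5$ minor does not have the homomorphism preservation property.
   Context: Graphs are simple and undirected. A first-order sentence $\phi$ in the language of graphs is preserved by homomorphisms over a class $\mathcal{C}$ if for all $A,B\in\mathcal{C}$ with a homomorphism $A\to B$, $A\models\phi$ implies $B\models\phi$. $\mathcal{C}$ has the homomorphism preservation property if every first-order sentence preserved by homomorphisms over $\mathcal{C}$ is equivalent on all graphs of $\mathcal{C}$ to an existential-positive first-order sentence. -}

module Defs where

open import Data.Nat using (ℕ; zero; suc)
open import Data.Fin using (Fin; zero; suc)
open import Data.Bool using (Bool; true; false; _∧_; _∨_; not; T)
open import Data.Maybe using (Maybe; just; nothing)
open import Data.Product using (Σ; _×_; _,_; ∃)
open import Relation.Binary.PropositionalEquality using (_≡_)
open import Relation.Nullary using (¬_)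
open import Data.Fin using (_≟_)
open import Relation.Nullary.Decidable using (⌊_⌋)
open import Function.Bundles using (_⇔_)

record Graph : Set where
  field
    size  : ℕ
    adj   : Fin size → Fin size → Bool
    sym   : ∀ u v → adj u v ≡ adj v u
    irrefl : ∀ v → adj v v ≡ false
open Graph public

Hom : Graph → Graph → Set
Hom G H = Σ (Fin (size G) → Fin (size H)) λ f →
  ∀ u v → adj G u v ≡ true → adj H (f u) (f v) ≡ true

-- Minors.  G has a K5 minor iff there are 5 pairwise disjoint, nonempty,
-- connected vertex sets (branch sets), any two joined by an edge of G.
-- Disjointness is built in: β assigns each vertex at most one branch set.

data PathIn (G : Graph) (P : Fin (size G) → Set) : Fin (size G) → Fin (size G) → Set where
  here : ∀ {u} → P u → PathIn G P u u
  step : ∀ {u v w} → P u → adj G u v ≡ true → PathIn G P v w → PathIn G P u w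

ConnectedSet : (G : Graph) → (Fin (size G) → Set) → Set
ConnectedSet G P = ∀ u v → P u → P v → PathIn G P u v

record K5Model (G : Graph) : Set where
  field
    β         : Fin (size G) → Maybe (Fin 5)
    nonempty  : ∀ i → ∃ λ v → β v ≡ just i
    connected : ∀ i → ConnectedSet G (λ v → β v ≡ just i)
    adjacent  : ∀ i j → ¬ (i ≡ j) →
                ∃ λ u → ∃ λ v → (β u ≡ just i) × (β v ≡ just j) × (adj G u v ≡ true)

HasK5Minor : Graph → Set
HasK5Minor G = K5Model G

K5MinorFree : Graph → Set
K5MinorFree G = ¬ HasK5Minor G

data Formula : ℕ → Set where
  ⊤'   : ∀ {k} → Formula k
  ⊥'   : ∀ {k} → Formula k
  _≐_  : ∀ {k} → Fin k → Fin k → Formula k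
  E    : ∀ {k} → Fin k → Fin k → Formula k
  ¬'_  : ∀ {k} → Formula k → Formula k
  _∧'_ : ∀ {k} → Formula k → Formula k → Formula k
  _∨'_ : ∀ {k} → Formula k → Formula k → Formula k
  ∃'   : ∀ {k} → Formula (suc k) → Formula k
  ∀'   : ∀ {k} → Formula (suc k) → Formula k

Sentence : Set
Sentence = Formula zero

data ExPos : ∀ {k} → Formula k → Set where
  ep-⊤  : ∀ {k} → ExPos (⊤' {k})
  ep-⊥  : ∀ {k} → ExPos (⊥' {k})
  ep-≐  : ∀ {k} (x y : Fin k) → ExPos (x ≐ y)
  ep-E  : ∀ {k} (x y : Fin k) → ExPos (E x y)
  ep-∧  : ∀ {k} {φ ψ : Formula k} → ExPos φ → ExPos ψ → ExPos (φ ∧' ψ)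
  ep-∨  : ∀ {k} {φ ψ : Formula k} → ExPos φ → ExPos ψ → ExPos (φ ∨' ψ)
  ep-∃  : ∀ {k} {φ : Formula (suc k)} → ExPos φ → ExPos (∃' φ)

anyFin : ∀ {n} → (Fin n → Bool) → Bool
anyFin {zero}  f = false
anyFin {suc n} f = f zero ∨ anyFin (λ i → f (suc i))

allFin : ∀ {n} → (Fin n → Bool) → Bool
allFin {zero}  f = true
allFin {suc n} f = f zero ∧ allFin (λ i → f (suc i))

extend : ∀ {k n} → Fin n → (Fin k → Fin n) → Fin (suc k) → Fin n
extend a ρ zero    = a
extend a ρ (suc i) = ρ i

eval : (G : Graph) → ∀ {k} → Formula k → (Fin k → Fin (size G)) → Bool
eval G ⊤'       ρ = true
eval G ⊥'       ρ = false
eval G (x ≐ y)  ρ = ⌊ ρ x ≟ ρ y ⌋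
eval G (E x y)  ρ = adj G (ρ x) (ρ y)
eval G (¬' φ)   ρ = not (eval G φ ρ)
eval G (φ ∧' ψ) ρ = eval G φ ρ ∧ eval G ψ ρ
eval G (φ ∨' ψ) ρ = eval G φ ρ ∨ eval G ψ ρ
eval G (∃' φ)   ρ = anyFin (λ a → eval G φ (extend a ρ))
eval G (∀' φ)   ρ = allFin (λ a → eval G φ (extend a ρ))

_⊨_ : Graph → Sentence → Set
G ⊨ φ = T (eval G φ (λ ()))

PreservedByHom : (Graph → Set) → Sentence → Set
PreservedByHom C φ = ∀ A B → C A → C B → Hom A B → A ⊨ φ → B ⊨ φ

EquivalentOn : (Graph → Set) → Sentence → Sentence → Set
EquivalentOn C φ ψ = ∀ G → C G → (G ⊨ φ) ⇔ (G ⊨ ψ)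

HPP : (Graph → Set) → Set
HPP C = ∀ φ → PreservedByHom C φ →
        Σ Sentence λ ψ → ExPos ψ × EquivalentOn C φ ψ

{-# OPTIONS --safe #-}

-- The graph belt k is a planar triangulation: a path u₀ … uₙ₋₁ whose vertices
-- are all adjacent to two poles a and b, closed up to a cycle separating the
-- poles by a small gadget x y z w. The sentence says "there is a K₄, or a gadget
-- such that every common neighbour of a and b other than the path ends p and q
-- has two neighbours that are common neighbours of a and b". In a K₄-free graph
-- without K₅ minor this is equivalent to the existence of a path from p to q
-- inside N(a) ∩ N(b): a cycle there would be crossed by the path a x z b, and a
-- common neighbour v off the path would give a path a v b crossing the cycle
-- formed by the path, x and z. Existence of a path is preserved by
-- homomorphisms. On the other hand, an existential-positive sentence true in a
-- long belt is witnessed without some uᵢ, and the belt without uᵢ folds onto a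
-- fixed graph, a belt with a missing path edge, in which the sentence fails.
-- That belts have no K₅ minor is shown by contracting path edges down to a path
-- on four vertices, where the branch sets are excluded by exhaustive search.
module Submission where

open import Defs
open import Data.Bool using (Bool; true; false; _∧_; _∨_; not; T)
open import Data.Bool.ListAction using (any; all)
open import Data.Bool.Properties using (T-≡; T-∧; T-∨; ∨-comm; ∨-zeroʳ) renaming (_≟_ to _≟ᵇ_)
open import Data.Empty using (⊥; ⊥-elim)
open import Data.Fin using (Fin; zero; suc; punchIn; punchOut; pinch; inject₁; fromℕ; splitAt; join; _↑ʳ_)
import Data.Fin as Fin
open import Data.Fin.Patterns using (0F; 1F; 2F; 3F; 4F; 5F; 6F; 7F; 8F; 9F)
open import Data.Fin.Properties using (injective⇒≤; punchIn-injective; punchInᵢ≢i; punchOut-injective; any?; splitAt-join; join-splitAt; suc-injective; ↑ʳ-injective)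
open import Data.List using (List; []; _∷_; _++_; length; filterᵇ; lookup)
import Data.List.Membership.DecPropositional as DecMembership
open import Data.List.Membership.Propositional using (_∈_; _∉_; lose)
open import Data.List.Membership.Propositional.Properties using (∈-++⁺ˡ; ∈-++⁺ʳ; ∈-++⁻; ∈-filter⁺; ∈-lookup)
open import Data.List.Properties using (length-++)
open import Data.List.Relation.Binary.Disjoint.Propositional using (Disjoint)
open import Data.List.Relation.Unary.All as All using (All; []; _∷_)
open import Data.List.Relation.Unary.All.Properties using (all⁻; ¬Any⇒All¬; All¬⇒¬Any)
open import Data.List.Relation.Unary.AllPairs using ([]; _∷_)
open import Data.List.Relation.Unary.Any as Any using (Any; here; there)
open import Data.List.Relation.Unary.Any.Properties using (any⁺; lookup-index)
open import Data.List.Relation.Unary.Unique.Propositional using (Unique)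
open import Data.Maybe using (Maybe; just; nothing)
import Data.Maybe.Properties as Maybe
open import Data.Nat using (ℕ; zero; suc; _+_; _≤_; _<_; _≤ᵇ_; _≡ᵇ_; z≤n; s≤s)
open import Data.Nat.Properties using (≤⇒≤ᵇ; <⇒≱; ≤-refl; ≤-reflexive; ≤-trans; +-comm; +-suc; +-mono-≤; m≤m+n; m≤n+m)
open import Data.Product using (Σ; ∃; _×_; _,_; proj₁; proj₂)
open import Data.Sum as Sum using (_⊎_; inj₁; inj₂; map₂)
import Data.Sum.Properties as Sum
open import Data.Unit using (⊤; tt)
open import Data.Vec as Vec using (Vec; []; _∷_)
import Data.Vec.Relation.Unary.All as VecAll
open import Data.Vec.Relation.Unary.All using ([]; _∷_)
open import Data.Vec.Relation.Unary.All.Properties using (lookup⁺)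
open import Data.Vec.Relation.Unary.AllPairs as VecAllPairs using ([]; _∷_)
open import Function using (_∘_; Equivalence; Injective)
open import Relation.Binary.Definitions using (DecidableEquality)
open import Relation.Binary.PropositionalEquality as ≡ using (_≡_; _≢_; refl; cong; cong₂; subst)
open import Relation.Nullary using (¬_; Dec; yes; no; contradiction; ¬?)
open import Relation.Nullary.Decidable using (⌊_⌋; T?; _×-dec_; map′; toWitness; fromWitness; decidable-stable)

open Equivalence using (to; from)

-- K₅ models and minors

Colour : Set
Colour = Maybe (Fin 5)

_≟ᶜ_ : DecidableEquality Colour
_≟ᶜ_ = Maybe.≡-dec Fin._≟_

injection-length : ∀ {A : Set} {m} (f : Fin m → A) → Injective _≡_ _≡_ f →
                   {xs : List A} → (∀ i → f i ∈ xs) → m ≤ length xs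
injection-length f f-inj {xs} f∈xs = injective⇒≤ {f = Any.index ∘ f∈xs} λ {i} {j} eq →
  f-inj (≡.trans (lookup-index (f∈xs i))
        (≡.trans (cong (lookup xs) eq) (≡.sym (lookup-index (f∈xs j)))))

-- Merging vertices creates loops, so K₅ models are needed for arbitrary
-- Boolean relations on arbitrary vertex types.
data Path {V : Set} (R : V → V → Bool) (P : V → Set) : V → V → Set where
  here : ∀ {u} → P u → Path R P u u
  step : ∀ {u v w} → P u → T (R u v) → Path R P v w → Path R P u w

record Model {V : Set} (R : V → V → Bool) : Set where
  field
    β         : V → Colour
    nonempty  : ∀ i → ∃ λ v → β v ≡ just i
    connected : ∀ {i u v} → β u ≡ just i → β v ≡ just i → Path R (λ s → β s ≡ just i) u v
    adjacent  : ∀ {i j} → i ≢ j → ∃ λ u → ∃ λ v → β u ≡ just i × β v ≡ just j × T (R u v)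

fromK5Model : ∀ {G} → K5Model G → Model (adj G)
fromK5Model {G} M = record
  { β         = β
  ; nonempty  = nonempty
  ; connected = λ {i} {u} {v} bu bv → path (connected i u v bu bv)
  ; adjacent  = λ {i} {j} i≢j → let u , v , bu , bv , e = adjacent i j i≢j in u , v , bu , bv , from T-≡ e
  }
  where
  open K5Model M
  path : ∀ {P u v} → PathIn G P u v → Path (adj G) P u v
  path (here p)     = here p
  path (step p e π) = step p (from T-≡ e) (path π)

path-start : ∀ {V : Set} {R : V → V → Bool} {P u v} → Path R P u v → P u
path-start (here p)     = p
path-start (step p _ _) = p

module _ {V W : Set} {R : V → V → Bool} {R′ : W → W → Bool} (M : Model R) where
  open Model M

  -- Edges may be collapsed by `f`, so contractions are covered as well as embeddings. An edge
  -- between different branch sets is never collapsed, since `push` would give its image two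
  -- colours; `pull` supplies preimages between which a path can be mapped.
  transfer : (f : V → W) (β′ : W → Colour) →
             (∀ {v i} → β v ≡ just i → β′ (f v) ≡ just i) →
             (∀ {w i} → β′ w ≡ just i → ∃ λ v → f v ≡ w × β v ≡ just i) →
             (∀ {u v} → T (R u v) → f u ≡ f v ⊎ T (R′ (f u) (f v))) →
             Model R′
  transfer f β′ push pull hom = record
    { β         = β′
    ; nonempty  = λ i → let v , bv = nonempty i in f v , push bv
    ; connected = conn
    ; adjacent  = adjc
    }
    where
    path : ∀ {i u v} → Path R (λ s → β s ≡ just i) u v → Path R′ (λ s → β′ s ≡ just i) (f u) (f v)
    path (here p) = here (push p)
    path (step p e π) with hom e
    ... | inj₁ eq rewrite eq = path π
    ... | inj₂ e′            = step (push p) e′ (path π)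

    conn : ∀ {i u v} → β′ u ≡ just i → β′ v ≡ just i → Path R′ (λ s → β′ s ≡ just i) u v
    conn bu bv with pull bu | pull bv
    ... | _ , refl , bu′ | _ , refl , bv′ = path (connected bu′ bv′)

    adjc : ∀ {i j} → i ≢ j → ∃ λ u → ∃ λ v → β′ u ≡ just i × β′ v ≡ just j × T (R′ u v)
    adjc i≢j with adjacent i≢j
    ... | u , v , bu , bv , e with hom e
    ...   | inj₂ e′ = f u , f v , push bu , push bv , e′
    ...   | inj₁ eq = contradiction (Maybe.just-injective
                        (≡.trans (≡.sym (push bu)) (≡.trans (cong β′ eq) (push bv)))) i≢j

module _ {V : Set} (_≟_ : DecidableEquality V) where

  erase : V → (V → Colour) → V → Colour
  erase k β v with v ≟ k
  ... | yes _ = nothing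
  ... | no  _ = β v

  erase-just : ∀ k β {v i} → erase k β v ≡ just i → v ≢ k × β v ≡ just i
  erase-just k β {v} eq with v ≟ k
  ... | no v≢k = v≢k , eq

  erase-other : ∀ {k v} β → v ≢ k → erase k β v ≡ β v
  erase-other {k} {v} β v≢k with v ≟ k
  ... | yes v≡k = contradiction v≡k v≢k
  ... | no  _   = refl

  erase-self : ∀ {k} β → erase k β k ≡ nothing
  erase-self {k} β with k ≟ k
  ... | yes _   = refl
  ... | no  k≢k = contradiction refl k≢k

  module _ {R : V → V → Bool} (R-sym : ∀ {u v} → T (R u v) → T (R v u)) (M : Model R) where
    open Model M

    -- A path inside the branch set that passes through `v` enters from `s` and returns to `s`, so
    -- the detour can be cut out. The hypothesis `contact` replaces each adjacency to another branch
    -- set that was witnessed at `v`.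
    discard-leaf : ∀ {v s c} → β v ≡ just c → s ≢ v → β s ≡ just c →
                   (∀ {t} → T (R v t) → β t ≡ just c → t ≡ s) →
                   (∀ {t d} → T (R v t) → β t ≡ just d → d ≢ c →
                     ∃ λ u′ → u′ ≢ v × β u′ ≡ just c × ∃ λ v′ → v′ ≢ v × β v′ ≡ just d × T (R u′ v′)) →
                   Model R
    discard-leaf {v} {s} {c} bv s≢v bs leaf contact = record
      { β         = β′
      ; nonempty  = full
      ; connected = λ bu bw → let u≢v , bu′ = erase-just v β bu ; w≢v , bw′ = erase-just v β bw
                              in path u≢v w≢v (connected bu′ bw′)
      ; adjacent  = adjc
      }
      where
      β′ : V → Colour
      β′ = erase v β

      keep : ∀ {u i} → u ≢ v → β u ≡ just i → β′ u ≡ just i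
      keep u≢v bu = ≡.trans (erase-other β u≢v) bu

      full : ∀ i → ∃ λ u → β′ u ≡ just i
      full i with nonempty i
      ... | u , bu with u ≟ v
      ...   | no u≢v = u , keep u≢v bu
      ...   | yes refl with ≡.trans (≡.sym bv) bu
      ...     | refl = s , keep s≢v bs

      path : ∀ {i u w} → u ≢ v → w ≢ v → Path R (λ t → β t ≡ just i) u w → Path R (λ t → β′ t ≡ just i) u w
      path u≢v w≢v (here p) = here (keep u≢v p)
      path u≢v w≢v (step {v = t} p e π) with t ≟ v
      path u≢v w≢v (step p e π)               | no t≢v   = step (keep u≢v p) e (path t≢v w≢v π)
      path u≢v w≢v (step p e (here q))        | yes refl = contradiction refl w≢v
      path u≢v w≢v (step p e (step q e′ π))   | yes refl with ≡.trans (≡.sym bv) q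
      ... | refl with leaf (R-sym e) p | leaf e′ (path-start π)
      ...   | refl | refl = path u≢v w≢v π

      adjc : ∀ {i j} → i ≢ j → ∃ λ u → ∃ λ w → β′ u ≡ just i × β′ w ≡ just j × T (R u w)
      adjc i≢j with adjacent i≢j
      ... | u , w , bu , bw , e with u ≟ v | w ≟ v
      ...   | no u≢v   | no w≢v = u , w , keep u≢v bu , keep w≢v bw , e
      ...   | yes refl | _ with ≡.trans (≡.sym bv) bu
      ...     | refl with contact e bw (i≢j ∘ ≡.sym)
      ...       | u′ , u′≢v , bu′ , w′ , w′≢v , bw′ , e′ = u′ , w′ , keep u′≢v bu′ , keep w′≢v bw′ , e′
      adjc i≢j | u , w , bu , bw , e | no _ | yes refl with ≡.trans (≡.sym bv) bw
      ...     | refl with contact (R-sym e) bu i≢j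
      ...       | w′ , w′≢v , bw′ , u′ , u′≢v , bu′ , e′ = u′ , w′ , keep u′≢v bu′ , keep w′≢v bw′ , R-sym e′

module _ {V : Set} {R : V → V → Bool} (M : Model R) where
  open Model M

  -- A path inside the branch set that starts at `v` can only loop at `v`.
  singleton-branch : ∀ {v c} → β v ≡ just c → (∀ {s} → T (R v s) → β s ≡ just c → s ≡ v) →
                     ∀ {t} → β t ≡ just c → t ≡ v
  singleton-branch {v} {c} bv isolated bt = go (connected bv bt)
    where
    go : ∀ {t} → Path R (λ s → β s ≡ just c) v t → t ≡ v
    go (here _) = refl
    go (step _ e π) with isolated e (path-start π)
    ... | refl = go π

  colours-in : (L : List V) → (∀ i → ∃ λ v → v ∈ L × β v ≡ just i) → 5 ≤ length L
  colours-in L rep = injection-length (proj₁ ∘ rep) inj (proj₁ ∘ proj₂ ∘ rep)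
    where
    inj : Injective _≡_ _≡_ (proj₁ ∘ rep)
    inj {i} {j} eq = Maybe.just-injective
      (≡.trans (≡.sym (proj₂ (proj₂ (rep i)))) (≡.trans (cong β eq) (proj₂ (proj₂ (rep j)))))

-- Exhaustive search for K₅ models

module Search {V : Set} (_≟_ : DecidableEquality V) where

  -- The vertex type stays fixed: `w` inherits the edges of `k`, and the contraction is completed by
  -- leaving `k` out of the lists of remaining vertices.
  merge : V → V → (V → V → Bool) → V → V → Bool
  merge k w R s t = R s t ∨ ((⌊ s ≟ w ⌋ ∧ R k t) ∨ (⌊ t ≟ w ⌋ ∧ R s k))

  -- Every vertex of F must see all five colours, its own one through a loop.
  viable : List V → (V → V → Bool) → List V → Bool
  viable os R F = (5 ≤ᵇ length (F ++ os)) ∧ all (λ f → 5 ≤ᵇ length (filterᵇ (R f) (F ++ os))) F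

  -- F collects the vertices that are branch sets by themselves. Any other vertex
  -- k can be merged into a later neighbour: one in the same branch set, or an
  -- arbitrary one if k is in no branch set.
  mutual
    possible : List V → (V → V → Bool) → List V → Bool
    possible []       R F = viable [] R F
    possible (k ∷ os) R F = viable (k ∷ os) R F ∧
      ((all (R k) F ∧ possible os R (k ∷ F)) ∨ mergeable k os R F (filterᵇ (R k) os))

    mergeable : V → List V → (V → V → Bool) → List V → List V → Bool
    mergeable k os R F []         = possible os R F
    mergeable k os R F ws@(_ ∷ _) = any (λ w → possible os (merge k w R) F) ws

  -- The invariant of the search, relating its lists to a given model.
  record Consistent (os : List V) (R : V → V → Bool) (F : List V) (M : Model R) : Set where
    open Model M
    field
      loops : ∀ v → T (R v v)
      cover : ∀ {v i} → β v ≡ just i → v ∈ F ++ os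
      alone : ∀ {f} → f ∈ F → ∃ λ c → β f ≡ just c × ∀ {v} → β v ≡ just c → v ≡ f

  merge-⊇ : ∀ k w R {s t} → T (R s t) → T (merge k w R s t)
  merge-⊇ k w R e = from T-∨ (inj₁ e)

  merge-source : ∀ k w R {t} → T (R k t) → T (merge k w R w t)
  merge-source k w R {t} e = from (T-∨ {R w t}) (inj₂
    (from (T-∨ {⌊ w ≟ w ⌋ ∧ R k t}) (inj₁ (from T-∧ (fromWitness {a? = w ≟ w} refl , e)))))

  merge-target : ∀ k w R {s} → T (R s k) → T (merge k w R s w)
  merge-target k w R {s} e = from (T-∨ {R s w}) (inj₂
    (from (T-∨ {⌊ s ≟ w ⌋ ∧ R k w}) (inj₂ (from T-∧ (fromWitness {a? = w ≟ w} refl , e)))))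

  module _ {R : V → V → Bool} (M : Model R) where
    open Model M

    absorb : ∀ {k w} → (∀ {c} → β k ≡ just c → β w ≡ just c) → w ≢ k → Model (merge k w R)
    absorb {k} {w} same w≢k = transfer M f (erase _≟_ k β) push pull hom
      where
      f : V → V
      f v with v ≟ k
      ... | yes _ = w
      ... | no  _ = v

      push : ∀ {v i} → β v ≡ just i → erase _≟_ k β (f v) ≡ just i
      push {v} bv with v ≟ k
      ... | yes refl = ≡.trans (erase-other _≟_ β w≢k) (same bv)
      ... | no  v≢k  = ≡.trans (erase-other _≟_ β v≢k) bv

      pull : ∀ {v i} → erase _≟_ k β v ≡ just i → ∃ λ u → f u ≡ v × β u ≡ just i
      pull {v} eq with v ≟ k in dec
      ... | no _ = v , fixed , eq
        where
        fixed : f v ≡ v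
        fixed rewrite dec = refl

      hom : ∀ {u v} → T (R u v) → f u ≡ f v ⊎ T (merge k w R (f u) (f v))
      hom {u} {v} e with u ≟ k | v ≟ k
      ... | yes refl | yes refl = inj₁ refl
      ... | yes refl | no _     = inj₂ (merge-source k w R e)
      ... | no _     | yes refl = inj₂ (merge-target k w R e)
      ... | no _     | no _     = inj₂ (merge-⊇ k w R e)

    viable-sound : ∀ {os F} → Consistent os R F M → T (viable os R F)
    viable-sound {os} {F} C = from T-∧
      ( ≤⇒≤ᵇ (colours-in M (F ++ os) λ i → let v , bv = nonempty i in v , cover bv , bv)
      , all⁻ _ (All.tabulate λ f∈F → ≤⇒≤ᵇ (colours-in M _ (around f∈F))))
      where
      open Consistent C
      around : ∀ {f} → f ∈ F → ∀ i → ∃ λ v → v ∈ filterᵇ (R f) (F ++ os) × β v ≡ just i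
      around {f} f∈F i with alone f∈F
      ... | c , bf , uniq with c Fin.≟ i
      ...   | yes refl = f , ∈-filter⁺ (T? ∘ R f) (∈-++⁺ˡ f∈F) (loops f) , bf
      ...   | no  c≢i with adjacent c≢i
      ...     | u , v , bu , bv , e with uniq bu
      ...       | refl = v , ∈-filter⁺ (T? ∘ R f) (cover bv) e , bv

  drop-middle : ∀ F {k os} {v : V} → v ∈ F ++ k ∷ os → v ≢ k → v ∈ F ++ os
  drop-middle F v∈ v≢k with ∈-++⁻ F v∈
  ... | inj₁ v∈F            = ∈-++⁺ˡ v∈F
  ... | inj₂ (here v≡k)     = contradiction v≡k v≢k
  ... | inj₂ (there v∈os)   = ∈-++⁺ʳ F v∈os

  move-middle : ∀ F {k os} {v : V} → v ∈ F ++ k ∷ os → v ∈ k ∷ F ++ os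
  move-middle F v∈ with ∈-++⁻ F v∈
  ... | inj₁ v∈F            = there (∈-++⁺ˡ v∈F)
  ... | inj₂ (here v≡k)     = here v≡k
  ... | inj₂ (there v∈os)   = there (∈-++⁺ʳ F v∈os)

  mutual
    possible-sound : ∀ os {R F} (M : Model R) → Consistent os R F M → T (possible os R F)
    possible-sound []               M C = viable-sound M C
    possible-sound (k ∷ os) {R} {F} M C = from T-∧ (viable-sound M C , from T-∨ (branch (β k) refl))
      where
      open Model M
      open Consistent C

      branch : ∀ c → β k ≡ c → T (all (R k) F ∧ possible os R (k ∷ F)) ⊎
                               T (mergeable k os R F (filterᵇ (R k) os))
      branch nothing bk = inj₂ (mergeable-sound-unused k M C bk (filterᵇ (R k) os))
      branch (just c) bk with Any.any? (λ w → (β w ≟ᶜ just c) ×-dec ¬? (w ≟ k)) (filterᵇ (R k) os)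
      ... | yes found = inj₂ (mergeable-sound k M C bk found)
      ... | no  none  = inj₁ (from T-∧ (all⁻ _ (All.tabulate touches) , possible-sound os M C′))
        where
        -- Another vertex of this colour next to `k` is ruled out in `os` by `none`, and in `F`
        -- because the members of `F` are alone in their branch sets. So `k` is a branch set by
        -- itself.
        isolated : ∀ {s} → T (R k s) → β s ≡ just c → s ≡ k
        isolated {s} e bs with s ≟ k | ∈-++⁻ F (cover bs)
        ... | yes s≡k | _                  = s≡k
        ... | no  s≢k | inj₂ (here s≡k)    = s≡k
        ... | no  s≢k | inj₂ (there s∈os)  = contradiction (lose (∈-filter⁺ (T? ∘ R k) s∈os e) (bs , s≢k)) none
        ... | no  s≢k | inj₁ s∈F with alone s∈F
        ...   | _ , bs′ , uniq with ≡.trans (≡.sym bs) bs′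
        ...     | refl = ≡.sym (uniq bk)

        unique : ∀ {v} → β v ≡ just c → v ≡ k
        unique = singleton-branch M bk isolated

        touches : ∀ {f} → f ∈ F → T (R k f)
        touches {f} f∈F with alone f∈F
        ... | d , bf , uniq with c Fin.≟ d
        ...   | yes refl = subst (λ v → T (R k v)) (uniq bk) (loops k)
        ...   | no  c≢d with adjacent c≢d
        ...     | u , v , bu , bv , e with unique bu | uniq bv
        ...       | refl | refl = e

        C′ : Consistent os R (k ∷ F) M
        C′ = record
          { loops = loops
          ; cover = λ bv → move-middle F (cover bv)
          ; alone = λ { (here refl) → c , bk , unique ; (there f∈F) → alone f∈F }
          }

    -- Additional edges never destroy a model, so an uncoloured `k` can be merged into whichever
    -- candidate comes first; without candidates it is just dropped.
    mergeable-sound-unused : ∀ k {os R F} (M : Model R) → Consistent (k ∷ os) R F M →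
                             Model.β M k ≡ nothing → ∀ ws → T (mergeable k os R F ws)
    mergeable-sound-unused k {os} {R} {F} M C bk = sound
      where
      open Model M
      open Consistent C

      used : ∀ {v i} → β v ≡ just i → v ≢ k
      used bv refl with ≡.trans (≡.sym bk) bv
      ... | ()

      sound : ∀ ws → T (mergeable k os R F ws)
      sound [] = possible-sound os M record
        { loops = loops ; cover = λ bv → drop-middle F (cover bv) (used bv) ; alone = alone }
      sound ws@(w ∷ _) = any⁺ {xs = ws} (λ w → possible os (merge k w R) F) (here (possible-sound os
        (transfer M (λ v → v) β (λ bv → bv) (λ bv → _ , refl , bv) (inj₂ ∘ merge-⊇ k w R)) record
        { loops = λ v → merge-⊇ k w R (loops v)
        ; cover = λ bv → drop-middle F (cover bv) (used bv)
        ; alone = alone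
        }))

    mergeable-sound : ∀ k {os R F} (M : Model R) → Consistent (k ∷ os) R F M →
                      ∀ {c ws} → Model.β M k ≡ just c →
                      Any (λ w → Model.β M w ≡ just c × w ≢ k) ws → T (mergeable k os R F ws)
    mergeable-sound k {os} {R} {F} M C {c} {w₀ ∷ ws} bk found = any⁺ _ (Any.map sound found)
      where
      open Model M
      open Consistent C

      sound : ∀ {w} → β w ≡ just c × w ≢ k → T (possible os (merge k w R) F)
      sound {w} (bw , w≢k) = possible-sound os
        (absorb M (λ bk′ → ≡.trans bw (≡.trans (≡.sym bk) bk′)) w≢k) record
        { loops = λ v → merge-⊇ k w R (loops v)
        ; cover = λ bv → let v≢k , bv′ = erase-just _≟_ k β bv in drop-middle F (cover bv′) v≢k
        ; alone = λ f∈F → let d , bf , uniq = alone f∈F in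
            -- `f` survives the erasure: if it were `k`, then `w` would lie in its branch set and be
            -- equal to `k`.
            d , ≡.trans (erase-other _≟_ β (λ { refl → w≢k (uniq (≡.trans bw (≡.trans (≡.sym bk) bf))) })) bf
              , λ bv → uniq (proj₂ (erase-just _≟_ k β bv))
        }

  no-model : ∀ {R} os → (∀ v → T (R v v)) → (∀ v → v ∈ os) → possible os R [] ≡ false → ¬ Model R
  no-model os refl-R total impossible M =
    subst T impossible (possible-sound os M record { loops = refl-R ; cover = λ _ → total _ ; alone = λ () })

-- The belts

Vertex : ℕ → Set
Vertex n = Fin 6 ⊎ Fin n

pattern 𝕒 = inj₁ 0F
pattern 𝕓 = inj₁ 1F
pattern 𝕩 = inj₁ 2F
pattern 𝕪 = inj₁ 3F
pattern 𝕫 = inj₁ 4F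
pattern 𝕨 = inj₁ 5F
pattern 𝕦 i = inj₂ i

isFirst isLast : ∀ {n} → Fin n → Bool
isFirst zero    = true
isFirst (suc _) = false
isLast {suc n} zero    = n ≡ᵇ 0
isLast {suc n} (suc i) = isLast i

next : ∀ {n} → Fin n → Fin n → Bool
next zero    (suc zero) = true
next (suc i) (suc j)    = next i j
next _       _          = false

hubArc : Fin 6 → Fin 6 → Bool
hubArc 0F 2F = true
hubArc 0F 3F = true
hubArc 1F 4F = true
hubArc 1F 5F = true
hubArc 2F 3F = true
hubArc 2F 4F = true
hubArc 2F 5F = true
hubArc 3F 4F = true
hubArc 4F 5F = true
hubArc _  _  = false

spoke : ∀ {n} → Fin 6 → Fin n → Bool
spoke 0F i = true
spoke 1F i = true
spoke 2F i = isLast i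
spoke 3F i = isFirst i
spoke 4F i = isFirst i
spoke 5F i = isLast i

-- The relation `S` on the path is a parameter because both the full path `next` and the interrupted
-- path `cut` are used.
arc edge : ∀ {n} → (Fin n → Fin n → Bool) → Vertex n → Vertex n → Bool
arc S (inj₁ h) (inj₁ k) = hubArc h k
arc S (inj₁ h) (𝕦 i)    = spoke h i
arc S (𝕦 i)    (inj₁ h) = false
arc S (𝕦 i)    (𝕦 j)    = S i j
edge S s t = arc S s t ∨ arc S t s

edge-sym : ∀ {n} (S : Fin n → Fin n → Bool) s t → edge S s t ≡ edge S t s
edge-sym S s t = ∨-comm (arc S s t) (arc S t s)

edge-symᵀ : ∀ {n} (S : Fin n → Fin n → Bool) {s t} → T (edge S s t) → T (edge S t s)
edge-symᵀ S {s} {t} = subst T (edge-sym S s t)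

module _ {m n} {S : Fin m → Fin m → Bool} {S′ : Fin n → Fin n → Bool}
         (Q : Fin m → Set) (φ : Fin m → Fin n) (X : Vertex n → Vertex n → Set)
         (X-sym : ∀ {s t} → X s t → X t s) (edge⇒X : ∀ {s t} → T (edge S′ s t) → X s t)
         (first : ∀ {i} → Q i → T (isFirst i) → T (isFirst (φ i)))
         (last  : ∀ {i} → Q i → T (isLast i) → T (isLast (φ i)))
         (succ  : ∀ {i j} → Q i → Q j → T (S i j) → X (𝕦 (φ i)) (𝕦 (φ j))) where

  private
    f : Vertex m → Vertex n
    f = map₂ φ

    spoke-map : ∀ h {i} → Q i → T (spoke h i) → T (spoke h (φ i))
    spoke-map 0F q e = tt
    spoke-map 1F q e = tt
    spoke-map 2F q e = last q e
    spoke-map 3F q e = first q e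
    spoke-map 4F q e = first q e
    spoke-map 5F q e = last q e

    arc-map : ∀ {s t} → (∀ {i} → s ≡ 𝕦 i → Q i) → (∀ {i} → t ≡ 𝕦 i → Q i) → T (arc S s t) → X (f s) (f t)
    arc-map {inj₁ h} {inj₁ k} qs qt e = edge⇒X {inj₁ h} {inj₁ k} (from T-∨ (inj₁ e))
    arc-map {inj₁ h} {𝕦 i}    qs qt e = edge⇒X {inj₁ h} {𝕦 (φ i)} (from T-∨ (inj₁ (spoke-map h (qt refl) e)))
    arc-map {𝕦 i}    {𝕦 j}    qs qt e = succ (qs refl) (qt refl) e

  -- Lifts a map of path indices to the whole graph, fixing the six other vertices. The relation `X`
  -- is adjacency, or adjacency or equality for contractions; `Q` restricts attention to the indices
  -- at which the map behaves well.
  edge-map : ∀ {s t} → (∀ {i} → s ≡ 𝕦 i → Q i) → (∀ {i} → t ≡ 𝕦 i → Q i) → T (edge S s t) → X (f s) (f t)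
  edge-map {s} {t} qs qt e with to (T-∨ {arc S s t}) e
  ... | inj₁ st = arc-map {s} {t} qs qt st
  ... | inj₂ ts = X-sym (arc-map {t} {s} qt qs ts)

-- Contraction of path edges

isFirst-pinch : ∀ {n} (j : Fin n) {i} → T (isFirst i) → T (isFirst (pinch j i))
isFirst-pinch zero    {zero} e = tt
isFirst-pinch (suc j) {zero} e = tt

isLast-pinch : ∀ {n} (j : Fin n) {i} → T (isLast i) → T (isLast (pinch j i))
isLast-pinch zero    {suc i} e = e
isLast-pinch (suc j) {suc i} e = isLast-pinch j e

next-pinch : ∀ {n} (j : Fin n) {i k} → T (next i k) → pinch j i ≡ pinch j k ⊎ T (next (pinch j i) (pinch j k))
next-pinch zero          {zero}  {suc zero} e = inj₁ refl
next-pinch zero          {suc i} {suc k}    e = inj₂ e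
next-pinch (suc zero)    {zero}  {suc zero} e = inj₂ tt
next-pinch (suc (suc j)) {zero}  {suc zero} e = inj₂ tt
next-pinch (suc j)       {suc i} {suc k}    e = Sum.map₁ (cong suc) (next-pinch j e)

pinch-punchIn-inject₁ : ∀ {n} (j : Fin n) i → pinch j (punchIn (inject₁ j) i) ≡ i
pinch-punchIn-inject₁ zero    i       = refl
pinch-punchIn-inject₁ (suc j) zero    = refl
pinch-punchIn-inject₁ (suc j) (suc i) = cong suc (pinch-punchIn-inject₁ j i)

pinch-punchIn-suc : ∀ {n} (j : Fin n) i → pinch j (punchIn (suc j) i) ≡ i
pinch-punchIn-suc zero    zero    = refl
pinch-punchIn-suc zero    (suc i) = refl
pinch-punchIn-suc (suc j) zero    = refl
pinch-punchIn-suc (suc j) (suc i) = cong suc (pinch-punchIn-suc j i)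

punchIn-inject₁-pinch : ∀ {n} (j : Fin n) i →
  punchIn (inject₁ j) (pinch j i) ≡ i ⊎ (i ≡ inject₁ j × punchIn (inject₁ j) (pinch j i) ≡ suc j)
punchIn-inject₁-pinch zero    zero    = inj₂ (refl , refl)
punchIn-inject₁-pinch zero    (suc i) = inj₁ refl
punchIn-inject₁-pinch (suc j) zero    = inj₁ refl
punchIn-inject₁-pinch (suc j) (suc i) =
  Sum.map (cong suc) (λ (p , q) → cong suc p , cong suc q) (punchIn-inject₁-pinch j i)

punchIn-suc-pinch : ∀ {n} (j : Fin n) i →
  punchIn (suc j) (pinch j i) ≡ i ⊎ (i ≡ suc j × punchIn (suc j) (pinch j i) ≡ inject₁ j)
punchIn-suc-pinch zero    zero          = inj₁ refl
punchIn-suc-pinch zero    (suc zero)    = inj₂ (refl , refl)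
punchIn-suc-pinch zero    (suc (suc i)) = inj₁ refl
punchIn-suc-pinch (suc j) zero          = inj₁ refl
punchIn-suc-pinch (suc j) (suc i)       =
  Sum.map (cong suc) (λ (p , q) → cong suc p , cong suc q) (punchIn-suc-pinch j i)

module _ {n} (M : Model (edge (next {suc n}))) (j : Fin n) where
  open Model M

  private
    -- The section `g` of `pinch j` decides which end of the contracted edge passes on its colour;
    -- the last hypothesis says that the other end is uncoloured or agrees with it.
    collapse : (g : Fin n → Fin (suc n)) → (∀ i → pinch j (g i) ≡ i) →
               (∀ i {c} → β (𝕦 i) ≡ just c → β (𝕦 (g (pinch j i))) ≡ just c) →
               Model (edge (next {n}))
    collapse g section keeps = transfer M (map₂ (pinch j)) (β ∘ map₂ g) (λ {v} → push v) (λ {w} → pull w)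
      (λ {s} {t} → edge-map (λ _ → ⊤) (pinch j) (λ s t → s ≡ t ⊎ T (edge next s t))
        (λ {s} {t} → Sum.map ≡.sym (edge-symᵀ next {s} {t})) inj₂
        (λ _ → isFirst-pinch j) (λ _ → isLast-pinch j)
        (λ _ _ e → Sum.map (cong inj₂) (from T-∨ ∘ inj₁) (next-pinch j e)) {s} {t} (λ _ → tt) (λ _ → tt))
      where
      push : ∀ v {c} → β v ≡ just c → β (map₂ g (map₂ (pinch j) v)) ≡ just c
      push (inj₁ _) bv = bv
      push (𝕦 i)    bv = keeps i bv

      pull : ∀ w {c} → β (map₂ g w) ≡ just c → ∃ λ v → map₂ (pinch j) v ≡ w × β v ≡ just c
      pull (inj₁ h) bw = inj₁ h , refl , bw
      pull (𝕦 i)    bw = 𝕦 (g i) , cong inj₂ (section i) , bw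

  contract-left : (∀ {c} → β (𝕦 (inject₁ j)) ≡ just c → β (𝕦 (suc j)) ≡ just c) → Model (edge (next {n}))
  contract-left keep = collapse (punchIn (inject₁ j)) (pinch-punchIn-inject₁ j) keeps
    where
    keeps : ∀ i {c} → β (𝕦 i) ≡ just c → β (𝕦 (punchIn (inject₁ j) (pinch j i))) ≡ just c
    keeps i bi with punchIn-inject₁-pinch j i
    ... | inj₁ eq         rewrite eq = bi
    ... | inj₂ (refl , eq) rewrite eq = keep bi

  contract-right : (∀ {c} → β (𝕦 (suc j)) ≡ just c → β (𝕦 (inject₁ j)) ≡ just c) → Model (edge (next {n}))
  contract-right keep = collapse (punchIn (suc j)) (pinch-punchIn-suc j) keeps
    where
    keeps : ∀ i {c} → β (𝕦 i) ≡ just c → β (𝕦 (punchIn (suc j) (pinch j i))) ≡ just c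
    keeps i bi with punchIn-suc-pinch j i
    ... | inj₁ eq         rewrite eq = bi
    ... | inj₂ (refl , eq) rewrite eq = keep bi

  contract-or-differ : Model (edge (next {n})) ⊎
    ∃ λ c → ∃ λ d → β (𝕦 (inject₁ j)) ≡ just c × β (𝕦 (suc j)) ≡ just d × c ≢ d
  contract-or-differ with β (𝕦 (inject₁ j)) in eq₁ | β (𝕦 (suc j)) in eq₂
  ... | nothing | _       = inj₁ (contract-left λ b → contradiction (≡.trans (≡.sym eq₁) b) λ ())
  ... | just _  | nothing = inj₁ (contract-right λ b → contradiction (≡.trans (≡.sym eq₂) b) λ ())
  ... | just c  | just d with c Fin.≟ d
  ...   | yes refl = inj₁ (contract-left λ b → ≡.trans eq₂ (≡.trans (≡.sym eq₁) b))
  ...   | no  c≢d  = inj₂ (c , d , refl , refl , c≢d)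

-- Pigeonhole: if `f` agreed at `i` and `j`, the three positions other than `i` would already cover
-- the four colours other than `c`.
covering-distinct : (f : Fin 4 → Colour) (c : Fin 5) → (∀ {d} → d ≢ c → ∃ λ i → f i ≡ just d) →
                    ∀ i j → i ≢ j → f i ≢ f j
covering-distinct f c covers i j i≢j fi≡fj =
  <⇒≱ ≤-refl (injective⇒≤ {f = λ k → punchOut (proj₁ (proj₂ (avoid k)))} inj)
  where
  avoid : ∀ k → ∃ λ l → i ≢ l × f l ≡ just (punchIn c k)
  avoid k with covers (punchInᵢ≢i c k)
  ... | l , fl with i Fin.≟ l
  ...   | yes refl = j , i≢j , ≡.trans (≡.sym fi≡fj) fl
  ...   | no  i≢l  = l , i≢l , fl

  inj : Injective _≡_ _≡_ (λ k → punchOut (proj₁ (proj₂ (avoid k))))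
  inj {k} {k′} eq with avoid k | avoid k′
  ... | l , i≢l , fl | l′ , i≢l′ , fl′ with punchOut-injective i≢l i≢l′ eq
  ...   | refl = punchIn-injective c k k′ (Maybe.just-injective (≡.trans (≡.sym fl) fl′))

-- The neighbourhood of an inner path vertex. It has exactly as many vertices as there are colours
-- besides one's own, which makes the counting below tight.
nbrs : ∀ {n} → Fin n → Fin n → Fin 4 → Vertex n
nbrs l r 0F = 𝕒
nbrs l r 1F = 𝕓
nbrs l r 2F = 𝕦 l
nbrs l r 3F = 𝕦 r

link₁ : ∀ {k} {s} → T (edge (next {5 + k}) (𝕦 1F) s) → ∃ λ i → s ≡ nbrs 0F 2F i
link₁ {s = 𝕒} e = 0F , refl
link₁ {s = 𝕓} e = 1F , refl
link₁ {s = 𝕨} ()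
link₁ {s = 𝕦 0F} e = 2F , refl
link₁ {s = 𝕦 2F} e = 3F , refl

link₂ : ∀ {k} {s} → T (edge (next {5 + k}) (𝕦 2F) s) → ∃ λ i → s ≡ nbrs 1F 3F i
link₂ {s = 𝕒} e = 0F , refl
link₂ {s = 𝕓} e = 1F , refl
link₂ {s = 𝕨} ()
link₂ {s = 𝕦 1F} e = 2F , refl
link₂ {s = 𝕦 3F} e = 3F , refl

link₃ : ∀ {k} {s} → T (edge (next {5 + k}) (𝕦 3F) s) → ∃ λ i → s ≡ nbrs 2F 4F i
link₃ {s = 𝕒} e = 0F , refl
link₃ {s = 𝕓} e = 1F , refl
link₃ {s = 𝕨} ()
link₃ {s = 𝕦 2F} e = 2F , refl
link₃ {s = 𝕦 4F} e = 3F , refl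

_≟ᵛ_ : ∀ {n} → DecidableEquality (Vertex n)
_≟ᵛ_ = Sum.≡-dec Fin._≟_ Fin._≟_

module _ {k} (M : Model (edge (next {5 + k}))) where
  open Model M

  private
    -- No neighbour has the colour of `v`, so `v` is a whole branch set, and its neighbours must
    -- then provide its contact to every other branch set.
    surrounded : ∀ {v l r c} → (∀ {s} → T (edge next v s) → ∃ λ i → s ≡ nbrs l r i) →
                 β v ≡ just c → (∀ i → β (nbrs l r i) ≢ just c) →
                 (∀ {t} → β t ≡ just c → t ≡ v) × (∀ {d} → d ≢ c → ∃ λ i → β (nbrs l r i) ≡ just d)
    surrounded {v} {l} {r} {c} link bv other = alone , covers
      where
      alone : ∀ {t} → β t ≡ just c → t ≡ v
      alone = singleton-branch M bv λ e bs →
        let i , s≡ = link e in contradiction (≡.trans (cong β (≡.sym s≡)) bs) (other i)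

      covers : ∀ {d} → d ≢ c → ∃ λ i → β (nbrs l r i) ≡ just d
      covers d≢c with adjacent (d≢c ∘ ≡.sym)
      ... | u , w , bu , bw , e with alone bu
      ...   | refl with link e
      ...     | i , refl = i , bw

    Poles : Fin 6 → Fin 6 → Set
    Poles s o = (s ≡ 0F × o ≡ 1F) ⊎ (s ≡ 1F × o ≡ 0F)

    link-u₂ : ∀ {s o t} → Poles s o → T (edge (next {5 + k}) (𝕦 2F) t) →
              t ≡ inj₁ s ⊎ t ≡ inj₁ o ⊎ t ≡ 𝕦 1F ⊎ t ≡ 𝕦 3F
    link-u₂ {t = t} poles e with link₂ {s = t} e | poles
    ... | 0F , eq | inj₁ (refl , refl) = inj₁ eq
    ... | 0F , eq | inj₂ (refl , refl) = inj₂ (inj₁ eq)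
    ... | 1F , eq | inj₁ (refl , refl) = inj₂ (inj₁ eq)
    ... | 1F , eq | inj₂ (refl , refl) = inj₁ eq
    ... | 2F , eq | _                  = inj₂ (inj₂ (inj₁ eq))
    ... | 3F , eq | _                  = inj₂ (inj₂ (inj₂ eq))

    -- Inside its branch set `u₂` hangs on the pole `s` alone. That pole sees `u₁` and `u₃`
    -- directly, and `u₁` stands in for the other pole, whose colour it shares. Once `u₂` is
    -- uncoloured, the edge from `u₁` to `u₂` can be contracted.
    discard-u₂ : ∀ {s o c d} → (∀ i → T (edge (next {5 + k}) (inj₁ s) (𝕦 i))) →
                 Poles s o →
                 β (inj₁ s) ≡ just c → β (inj₁ o) ≡ just d → β (𝕦 1F) ≡ just d → β (𝕦 2F) ≡ just c →
                 c ≢ d → β (𝕦 3F) ≢ just c → Model (edge (next {4 + k}))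
    discard-u₂ {s} {o} {c} {d} s~ poles bs bo b₁ b₂ c≢d b₃ = contract-right M′ 1F λ b →
        contradiction (≡.trans (≡.sym (erase-self _≟ᵛ_ {𝕦 2F} β)) b) λ ()
      where
      clash : ∀ {v} → β v ≡ just d → β v ≢ just c
      clash bd bc = c≢d (Maybe.just-injective (≡.trans (≡.sym bc) bd))

      leaf : ∀ {t} → T (edge next (𝕦 2F) t) → β t ≡ just c → t ≡ inj₁ s
      leaf {t} e bt with link-u₂ {t = t} poles e
      ... | inj₁ eq                        = eq
      ... | inj₂ (inj₁ refl)               = contradiction bt (clash bo)
      ... | inj₂ (inj₂ (inj₁ refl))        = contradiction bt (clash b₁)
      ... | inj₂ (inj₂ (inj₂ refl))        = contradiction bt b₃

      contact : ∀ {t e} → T (edge next (𝕦 2F) t) → β t ≡ just e → e ≢ c →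
                ∃ λ u → u ≢ 𝕦 2F × β u ≡ just c × ∃ λ v → v ≢ 𝕦 2F × β v ≡ just e × T (edge next u v)
      contact {t} e bt e≢c with link-u₂ {t = t} poles e
      ... | inj₁ refl = contradiction (Maybe.just-injective (≡.trans (≡.sym bt) bs)) e≢c
      ... | inj₂ (inj₁ refl) =
            inj₁ s , (λ ()) , bs , 𝕦 1F , (λ ()) , ≡.trans b₁ (≡.trans (≡.sym bo) bt) , s~ 1F
      ... | inj₂ (inj₂ (inj₁ refl)) = inj₁ s , (λ ()) , bs , 𝕦 1F , (λ ()) , bt , s~ 1F
      ... | inj₂ (inj₂ (inj₂ refl)) = inj₁ s , (λ ()) , bs , 𝕦 3F , (λ ()) , bt , s~ 3F

      M′ : Model (edge (next {5 + k}))
      M′ = discard-leaf _≟ᵛ_ (λ {u} {v} → edge-symᵀ next {u} {v}) M b₂ (λ ()) bs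
             (λ {t} → leaf {t}) (λ {t} → contact {t})

  -- If no two consecutive vertices among u₀, …, u₄ can be merged outright, then
  -- u₁ and u₂ lie in the branch sets of the two poles, and u₂ is redundant.
  shorten : Model (edge (next {4 + k}))
  shorten with contract-or-differ M 0F | contract-or-differ M 1F
             | contract-or-differ M 2F | contract-or-differ M 3F
  ... | inj₁ M′ | _ | _ | _ = M′
  ... | _ | inj₁ M′ | _ | _ = M′
  ... | _ | _ | inj₁ M′ | _ = M′
  ... | _ | _ | _ | inj₁ M′ = M′
  ... | inj₂ (c₀ , c₁ , b₀ , b₁ , c₀≢c₁) | inj₂ (c₁′ , c₂ , b₁′ , b₂ , c₁≢c₂)
      | inj₂ (c₂′ , c₃ , b₂′ , b₃ , c₂≢c₃) | inj₂ (c₃′ , c₄ , b₃′ , b₄ , c₃≢c₄)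
      with refl ← ≡.trans (≡.sym b₁) b₁′ | refl ← ≡.trans (≡.sym b₂) b₂′
         | refl ← ≡.trans (≡.sym b₃) b₃′ = conclude
    where
    differ : ∀ {v c d} → β v ≡ just c → c ≢ d → β v ≢ just d
    differ bc c≢d bd = c≢d (Maybe.just-injective (≡.trans (≡.sym bc) bd))

    u₁-surrounded : β 𝕒 ≢ just c₁ → β 𝕓 ≢ just c₁ →
               (∀ {t} → β t ≡ just c₁ → t ≡ 𝕦 1F) × (∀ {d} → d ≢ c₁ → ∃ λ i → β (nbrs 0F 2F i) ≡ just d)
    u₁-surrounded a≢ b≢ = surrounded link₁ b₁ λ where
      0F → a≢
      1F → b≢
      2F → differ b₀ c₀≢c₁
      3F → differ b₂ (c₁≢c₂ ∘ ≡.sym)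

    -- If neither pole has the colour of `u₂`, then `u₂` is a branch set by itself and its
    -- neighbours, both poles, `u₁` and `u₃`, have distinct colours. Hence `u₁` and `u₃` are branch
    -- sets by themselves too. But then only `u₀` could give `u₁` contact to the colour of `u₃`.
    u₂-polar-coloured : β 𝕒 ≢ just c₂ → β 𝕓 ≢ just c₂ → ⊥
    u₂-polar-coloured a≢ b≢ = contradiction (proj₁ around₃ u₀-colour) λ ()
      where
      around₂ = surrounded link₂ b₂ λ where
        0F → a≢
        1F → b≢
        2F → differ b₁ c₁≢c₂
        3F → differ b₃ (c₂≢c₃ ∘ ≡.sym)
      distinct = covering-distinct (β ∘ nbrs 1F 3F) c₂ (proj₂ around₂)

      unlike : ∀ i j → i ≢ j → ∀ {c} → β (nbrs 1F 3F j) ≡ just c → β (nbrs 1F 3F i) ≢ just c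
      unlike i j i≢j bj bi = distinct i j i≢j (≡.trans bi (≡.sym bj))

      around₁ = u₁-surrounded (unlike 0F 2F (λ ()) b₁) (unlike 1F 2F (λ ()) b₁)

      around₃ = surrounded link₃ b₃ λ where
        0F → unlike 0F 3F (λ ()) b₃
        1F → unlike 1F 3F (λ ()) b₃
        2F → differ b₂ c₂≢c₃
        3F → differ b₄ (c₃≢c₄ ∘ ≡.sym)

      u₀-colour : β (𝕦 0F) ≡ just c₃
      u₀-colour with proj₂ around₁ {c₃} (λ { refl → unlike 2F 3F (λ ()) b₃ b₁ })
      ... | 0F , b = contradiction b (unlike 0F 3F (λ ()) b₃)
      ... | 1F , b = contradiction b (unlike 1F 3F (λ ()) b₃)
      ... | 2F , b = b
      ... | 3F , b = contradiction b (differ b₂ c₂≢c₃)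

    conclude : Model (edge (next {4 + k}))
    conclude with β 𝕒 ≟ᶜ just c₂ | β 𝕓 ≟ᶜ just c₂ | β 𝕒 ≟ᶜ just c₁ | β 𝕓 ≟ᶜ just c₁
    ... | no a≢ | no b≢ | _ | _ = ⊥-elim (u₂-polar-coloured a≢ b≢)
    ... | yes a₂ | _ | _ | yes b₁′ = discard-u₂ {0F} (λ _ → tt) (inj₁ (refl , refl)) a₂ b₁′ b₁ b₂
            (c₁≢c₂ ∘ ≡.sym) (differ b₃ (c₂≢c₃ ∘ ≡.sym))
    ... | _ | yes b₂′ | yes a₁ | _ = discard-u₂ {1F} (λ _ → tt) (inj₂ (refl , refl)) b₂′ a₁ b₁ b₂
            (c₁≢c₂ ∘ ≡.sym) (differ b₃ (c₂≢c₃ ∘ ≡.sym))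
    ... | yes a₂ | _ | yes a₁ | _ = contradiction a₂ (differ a₁ c₁≢c₂)
    ... | _ | yes b₂′ | _ | yes b₁′ = contradiction b₂′ (differ b₁′ c₁≢c₂)
    -- If no pole has the colour of `u₁`, then `u₁` is a branch set by itself and its four
    -- neighbours have distinct colours; yet a pole and `u₂` are two of them and agree.
    ... | yes a₂ | _ | no a≢ | no b≢ = contradiction (≡.trans a₂ (≡.sym b₂))
            (covering-distinct _ c₁ (proj₂ (u₁-surrounded a≢ b≢)) 0F 3F λ ())
    ... | _ | yes b₂′ | no a≢ | no b≢ = contradiction (≡.trans b₂′ (≡.sym b₂))
            (covering-distinct _ c₁ (proj₂ (u₁-surrounded a≢ b≢)) 1F 3F λ ())

-- The order only affects the running time of the search.
order : List (Vertex 4)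
order = 𝕦 2F ∷ 𝕦 1F ∷ 𝕪 ∷ 𝕦 0F ∷ 𝕒 ∷ 𝕦 3F ∷ 𝕓 ∷ 𝕩 ∷ 𝕨 ∷ 𝕫 ∷ []

order-total : ∀ v → v ∈ order
order-total (𝕦 2F) = here refl
order-total (𝕦 1F) = there (here refl)
order-total 𝕪      = there (there (here refl))
order-total (𝕦 0F) = there (there (there (here refl)))
order-total 𝕒      = there (there (there (there (here refl))))
order-total (𝕦 3F) = there (there (there (there (there (here refl)))))
order-total 𝕓      = there (there (there (there (there (there (here refl))))))
order-total 𝕩      = there (there (there (there (there (there (there (here refl)))))))
order-total 𝕨      = there (there (there (there (there (there (there (there (here refl))))))))
order-total 𝕫      = there (there (there (there (there (there (there (there (there (here refl)))))))))

no-model-4 : ¬ Model (edge (next {4}))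
-- The `refl` after `order-total` runs the whole search on ten vertices. Loops are added to the
-- relation because the search expects them.
no-model-4 M = no-model order (λ v → from T-∨ (inj₁ (fromWitness {a? = v ≟ᵛ v} refl))) order-total refl
  (transfer {R′ = λ s t → ⌊ s ≟ᵛ t ⌋ ∨ edge next s t} M (λ v → v) (Model.β M) (λ b → b) (λ b → _ , refl , b)
    (λ {s} {t} e → inj₂ (from (T-∨ {⌊ s ≟ᵛ t ⌋}) (inj₂ e))))
  where open Search _≟ᵛ_

no-model-family : ∀ k → ¬ Model (edge (next {4 + k}))
no-model-family zero    = no-model-4
no-model-family (suc k) = no-model-family k ∘ shorten

-- Rigidity of the equator

module _ (G : Graph) where

  private
    V : Set
    V = Fin (size G)
    open DecMembership (Fin._≟_ {size G}) using (_∈?_)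

  infix 4 _~_
  _~_ : V → V → Set
  u ~ v = adj G u v ≡ true

  ~-sym : ∀ {u v} → u ~ v → v ~ u
  ~-sym {u} {v} e = ≡.trans (sym G v u) e

  ~⇒≢ : ∀ {u v} → u ~ v → u ≢ v
  ~⇒≢ {u} e refl with ≡.trans (≡.sym (irrefl G u)) e
  ... | ()

  -- Trails and the K₅ models they span

  data Trail : V → V → List V → Set where
    [_] : ∀ u → Trail u u (u ∷ [])
    _∷_ : ∀ {u v w l} → u ~ v → Trail v w l → Trail u w (u ∷ l)

  trail-first : ∀ {u w l} → Trail u w l → u ∈ l
  trail-first [ _ ]   = here refl
  trail-first (_ ∷ _) = here refl

  trail-last : ∀ {u w l} → Trail u w l → w ∈ l
  trail-last [ _ ]   = here refl
  trail-last (_ ∷ t) = there (trail-last t)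

  module _ {P : V → Set} where

    _++ᵖ_ : ∀ {u v w} → PathIn G P u v → PathIn G P v w → PathIn G P u w
    here _     ++ᵖ ρ = ρ
    step p e π ++ᵖ ρ = step p e (π ++ᵖ ρ)

    start : ∀ {u v} → PathIn G P u v → P u
    start (here p)     = p
    start (step p _ _) = p

    reverse : ∀ {u v} → PathIn G P u v → PathIn G P v u
    reverse (here p)     = here p
    reverse (step p e π) = reverse π ++ᵖ step (start π) (~-sym e) (here p)

    from-first : ∀ {u w l} → Trail u w l → All P l → ∀ {v} → v ∈ l → PathIn G P u v
    from-first [ _ ]   (p ∷ _)  (here refl) = here p
    from-first (_ ∷ _) (p ∷ _)  (here refl) = here p
    from-first (e ∷ t) (p ∷ ps) (there v∈l) = step p e (from-first t ps v∈l)

    trail-path : ∀ {u w l} → Trail u w l → All P l → PathIn G P u w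
    trail-path t ps = from-first t ps (trail-last t)

  IsTrail : List V → Set
  IsTrail l = ∃ λ u → ∃ λ w → Trail u w l

  Touching : List V → List V → Set
  Touching k l = Disjoint k l × ∃ λ u → ∃ λ v → u ∈ k × v ∈ l × u ~ v

  pairs : ∀ {n} {ls : Vec (List V) n} → VecAllPairs.AllPairs Touching ls →
          ∀ i j → i ≢ j → Touching (Vec.lookup ls i) (Vec.lookup ls j)
  pairs _        zero    zero    i≢j = contradiction refl i≢j
  pairs (p ∷ _)  zero    (suc j) _   = lookup⁺ p j
  pairs (p ∷ _)  (suc i) zero    _   with lookup⁺ p i
  ... | disj , u , v , u∈ , v∈ , e = (λ (x , y) → disj (y , x)) , v , u , v∈ , u∈ , ~-sym e
  pairs (_ ∷ ps) (suc i) (suc j) i≢j = pairs ps i j (i≢j ∘ cong suc)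

  module _ (ls : Vec (List V) 5) (trails : VecAll.All IsTrail ls)
           (touching : VecAllPairs.AllPairs Touching ls) where

    private
      β : V → Maybe (Fin 5)
      β v with any? (λ i → v ∈? Vec.lookup ls i)
      ... | yes (i , _) = just i
      ... | no  _       = nothing

      β⇒∈ : ∀ {v i} → β v ≡ just i → v ∈ Vec.lookup ls i
      β⇒∈ {v} eq with any? (λ i → v ∈? Vec.lookup ls i)
      β⇒∈ refl | yes (i , v∈) = v∈

      ∈⇒β : ∀ {v i} → v ∈ Vec.lookup ls i → β v ≡ just i
      ∈⇒β {v} {i} v∈ with any? (λ i → v ∈? Vec.lookup ls i)
      ... | no  none = contradiction (i , v∈) none
      ... | yes (j , v∈′) with j Fin.≟ i
      ...   | yes refl = refl
      ...   | no  j≢i  = contradiction (v∈′ , v∈) (proj₁ (pairs touching j i j≢i))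

    -- A trail connects any two of its vertices through its first one, and disjointness makes the
    -- index found by `any?` the only possible one.
    branch-sets : K5Model G
    branch-sets = record
      { β         = β
      ; nonempty  = λ i → let u , _ , t = lookup⁺ trails i in u , ∈⇒β (trail-first t)
      ; connected = λ i u v bu bv →
          let _ , _ , t = lookup⁺ trails i
              inside    = All.tabulate ∈⇒β
          in reverse (from-first t inside (β⇒∈ bu)) ++ᵖ from-first t inside (β⇒∈ bv)
      ; adjacent  = λ i j i≢j →
          let _ , u , v , u∈ , v∈ , e = pairs touching i j i≢j in u , v , ∈⇒β u∈ , ∈⇒β v∈ , e
      }

  unique-lookup : ∀ {l : List V} → Unique l → Injective _≡_ _≡_ (lookup l)
  unique-lookup (p ∷ ps) {zero}  {zero}  eq = refl
  unique-lookup {x ∷ l} (p ∷ ps) {zero}  {suc j} eq = contradiction eq (All.lookup p (∈-lookup j))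
  unique-lookup {x ∷ l} (p ∷ ps) {suc i} {zero}  eq = contradiction (≡.sym eq) (All.lookup p (∈-lookup i))
  unique-lookup (p ∷ ps) {suc i} {suc j} eq = cong suc (unique-lookup ps eq)

  unique-length : ∀ {l : List V} → Unique l → length l ≤ size G
  unique-length u = injective⇒≤ (unique-lookup u)

  -- Simple paths

  module _ {P : V → Set} where

    SimplePath : V → V → Set
    SimplePath u w = ∃ λ l → Trail u w l × Unique l × All P l

    suffix : ∀ {u w l} → Trail u w l → Unique l → All P l → ∀ {v} → v ∈ l → SimplePath v w
    suffix t@([ _ ])   q       p       (here refl) = _ , t , q , p
    suffix t@(_ ∷ _)   q       p       (here refl) = _ , t , q , p
    suffix (_ ∷ t)     (_ ∷ q) (_ ∷ p) (there v∈)  = suffix t q p v∈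

    loop-erase : ∀ {u w} → PathIn G P u w → SimplePath u w
    loop-erase (here p) = _ , [ _ ] , [] ∷ [] , p ∷ []
    loop-erase (step {u} p e π) with loop-erase π
    ... | l , t , q , ps with u ∈? l
    ...   | yes u∈l = suffix t q ps u∈l
    ...   | no  u∉l = u ∷ l , e ∷ t , ¬Any⇒All¬ l u∉l ∷ q , p ∷ ps

    two-neighbours : ∀ {u w l} → Trail u w l → Unique l → All P l → ∀ {v} → v ∈ l → v ≢ u → v ≢ w →
                     ∃ λ s → ∃ λ t → s ≢ t × v ~ s × v ~ t × P s × P t
    two-neighbours [ _ ]         q p (here v≡u)  v≢u v≢w = contradiction v≡u v≢u
    two-neighbours (e ∷ t)       q p (here v≡u)  v≢u v≢w = contradiction v≡u v≢u
    two-neighbours (e ∷ [ _ ])   q p (there (here v≡w)) v≢u v≢w = contradiction v≡w v≢w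
    two-neighbours (e ∷ e′ ∷ t)  (q ∷ _) (p ∷ _ ∷ ps) (there (here refl)) v≢u v≢w =
      _ , _ , All.lookup q (there (trail-first t)) , ~-sym e , e′ , p , All.lookup ps (trail-first t)
    two-neighbours (e ∷ t@(_ ∷ _)) (_ ∷ q) (_ ∷ p) (there v∈@(there v∈l)) v≢u v≢w =
      two-neighbours t q p v∈ (λ { refl → All.lookup (head q) v∈l refl }) v≢w
      where
      head : ∀ {x l} → Unique (x ∷ l) → All (x ≢_) l
      head (h ∷ _) = h

  -- Stops the trail just before its first visit to `s`, so that `s` can serve as a separate branch
  -- set next to the part kept.
  up-to : ∀ {u w l s} → Trail u w l → s ∈ l → s ≢ u →
          ∃ λ k → ∃ λ m → Trail u m k × m ~ s × s ∉ k × (∀ {v} → v ∈ k → v ∈ l)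
  up-to [ _ ]   (here s≡u) s≢u = contradiction s≡u s≢u
  up-to (_ ∷ _) (here s≡u) s≢u = contradiction s≡u s≢u
  up-to {u} {s = s} (_∷_ {v = v} e t) (there s∈) s≢u with s Fin.≟ v
  ... | yes refl = u ∷ [] , u , [ u ] , e , (λ { (here s≡u) → s≢u s≡u }) , λ { (here eq) → here eq }
  ... | no  s≢v with up-to t s∈ s≢v
  ...   | k , m , t′ , m~s , s∉k , k⊆l =
          u ∷ k , m , e ∷ t′ , m~s , (λ { (here s≡u) → s≢u s≡u ; (there s∈k) → s∉k s∈k })
          , λ { (here eq) → here eq ; (there v∈) → there (k⊆l v∈) }

  -- Frames and paths on the equator

  record K₄ : Set where
    constructor k₄
    field
      {c₁ c₂ c₃ c₄} : V
      e₁₂ : c₁ ~ c₂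
      e₁₃ : c₁ ~ c₃
      e₁₄ : c₁ ~ c₄
      e₂₃ : c₂ ~ c₃
      e₂₄ : c₂ ~ c₄
      e₃₄ : c₃ ~ c₄

  -- The gadget with its poles and the path ends `p` and `q`. As `Closed` asks nothing of `q`, the
  -- neighbour `r` is included to give a trail leaving `q` its first edge.
  record Frame : Set where
    field
      {a b x y z w p q r} : V
      a~x : a ~ x
      a~y : a ~ y
      x~y : x ~ y
      x~z : x ~ z
      y~z : y ~ z
      a~p : a ~ p
      y~p : y ~ p
      z~p : z ~ p
      b~z : b ~ z
      b~p : b ~ p
      b~w : b ~ w
      x~w : x ~ w
      z~w : z ~ w
      a~q : a ~ q
      b~q : b ~ q
      x~q : x ~ q
      w~q : w ~ q
      a~r : a ~ r
      b~r : b ~ r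
      q~r : q ~ r

    Equator : V → Set
    Equator v = a ~ v × b ~ v

    Closed : Set
    Closed = ∀ v → Equator v → v ≡ p ⊎ v ≡ q ⊎ ∃ λ s → ∃ λ t → s ≢ t × v ~ s × v ~ t × Equator s × Equator t

  module _ (minor-free : K5MinorFree G) (no-K₄ : ¬ K₄) (F : Frame) where
    open Frame F

    -- The vertices y and w serve to force these non-adjacencies, which keep the
    -- gadget from degenerating under homomorphisms.
    private
      z≁a : ¬ a ~ z
      z≁a e = no-K₄ (k₄ a~x a~y e x~y x~z y~z)
      x≁b : ¬ b ~ x
      x≁b e = no-K₄ (k₄ b~z b~w e z~w (~-sym x~z) (~-sym x~w))
      p≁x : ¬ x ~ p
      p≁x e = no-K₄ (k₄ x~y x~z e y~z y~p z~p)
      q≁z : ¬ z ~ q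
      q≁z e = no-K₄ (k₄ (~-sym x~z) z~w e x~w x~q w~q)

      a≢b : a ≢ b
      a≢b refl = z≁a b~z
      a≢z : a ≢ z
      a≢z refl = q≁z a~q
      x≢b : x ≢ b
      x≢b refl = p≁x b~p

      a∉ : ¬ Equator a
      a∉ (e , _) = ~⇒≢ e refl
      b∉ : ¬ Equator b
      b∉ (_ , e) = ~⇒≢ e refl
      x∉ : ¬ Equator x
      x∉ (_ , e) = x≁b e
      z∉ : ¬ Equator z
      z∉ (e , _) = z≁a e

      apart : ∀ {k l} → All (λ v → ¬ Equator v) k → All Equator l → Disjoint k l
      apart out inn (v∈k , v∈l) = All.lookup out v∈k (All.lookup inn v∈l)

      apart′ : ∀ {k l} → All Equator k → All (λ v → ¬ Equator v) l → Disjoint k l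
      apart′ inn out (v∈k , v∈l) = apart out inn (v∈l , v∈k)

    p≢q : p ≢ q
    p≢q refl = p≁x x~q

    -- The path a x z b crosses any cycle on the equator.
    no-cycle : ∀ {t u v l s} → t ~ u → Trail u v l → t ∉ l → Equator t → All Equator l →
               s ∈ l → s ≢ u → t ~ s → ⊥
    no-cycle {t} {u} {l = l} {s} t~u T t∉l et el s∈l s≢u t~s with up-to T s∈l s≢u
    -- The cycle is divided into the arcs `t`, `k` and `s`, which touch pairwise. Each touches both
    -- poles, and the edge from `x` to `z` joins the branch sets of the poles.
    ... | k , m , T′ , m~s , s∉k , k⊆l = minor-free (branch-sets
          ((a ∷ x ∷ []) ∷ (b ∷ z ∷ []) ∷ (t ∷ []) ∷ k ∷ (s ∷ []) ∷ [])
          ((_ , _ , a~x ∷ [ x ]) ∷ (_ , _ , b~z ∷ [ z ]) ∷ (_ , _ , [ t ]) ∷ (_ , _ , T′) ∷ (_ , _ , [ s ]) ∷ [])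
          ( ( ( (λ { (here refl , here eq)                 → a≢b eq
                   ; (here refl , there (here eq))         → a≢z eq
                   ; (there (here refl) , here eq)         → x≢b eq
                   ; (there (here refl) , there (here eq)) → ~⇒≢ x~z eq })
              , x , z , there (here refl) , there (here refl) , x~z)
            ∷ (apart ax (et ∷ []) , a , t , here refl , here refl , proj₁ et)
            ∷ (apart ax ek , a , u , here refl , trail-first T′ , proj₁ (All.lookup ek (trail-first T′)))
            ∷ (apart ax (es ∷ []) , a , s , here refl , here refl , proj₁ es)
            ∷ [])
          ∷ ( (apart bz (et ∷ []) , b , t , here refl , here refl , proj₂ et)
            ∷ (apart bz ek , b , u , here refl , trail-first T′ , proj₂ (All.lookup ek (trail-first T′)))
            ∷ (apart bz (es ∷ []) , b , s , here refl , here refl , proj₂ es)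
            ∷ [])
          ∷ ( ((λ { (here refl , t∈k) → t∉l (k⊆l t∈k) }) , t , u , here refl , trail-first T′ , t~u)
            ∷ ((λ { (here refl , here eq) → ~⇒≢ t~s eq }) , t , s , here refl , here refl , t~s)
            ∷ [])
          ∷ ( ((λ { (s∈k , here refl) → s∉k s∈k }) , m , s , trail-last T′ , here refl , m~s) ∷ [])
          ∷ [] ∷ []))
      where
      es = All.lookup el s∈l
      ek = All.tabulate (λ v∈k → All.lookup el (k⊆l v∈k))
      ax = a∉ ∷ x∉ ∷ []
      bz = b∉ ∷ z∉ ∷ []

    module _ (closed : Closed) where

      private
        -- The trail is grown backwards from `q`. Of the two equatorial neighbours of `t`, one is
        -- not `u`: if it is `p`, the path is complete; if it lies on the trail, it closes a
        -- forbidden cycle; otherwise it is added. The vertices are distinct, so `size G` bounds the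
        -- number of rounds.
        extend-trail : ∀ fuel {t u l} → size G < fuel + length l → t ~ u → Trail u q l → Unique (t ∷ l) →
                       All Equator (t ∷ l) → t ≢ p → PathIn G Equator p q
        extend-trail zero long _ _ (_ ∷ un) _ _ = contradiction (unique-length un) (<⇒≱ long)
        extend-trail (suc fuel) {t} {u} {l} long t~u T (t∉ ∷ un) (et ∷ el) t≢p with closed t et
        ... | inj₁ t≡p        = contradiction t≡p t≢p
        ... | inj₂ (inj₁ refl) = contradiction refl (All.lookup t∉ (trail-last T))
        ... | inj₂ (inj₂ (s₁ , s₂ , s₁≢s₂ , t~s₁ , t~s₂ , e₁ , e₂)) = proceed choose
          where
          choose : ∃ λ s → s ≢ u × t ~ s × Equator s
          choose with s₁ Fin.≟ u
          ... | no  s₁≢u = s₁ , s₁≢u , t~s₁ , e₁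
          ... | yes refl = s₂ , s₁≢s₂ ∘ ≡.sym , t~s₂ , e₂

          proceed : (∃ λ s → s ≢ u × t ~ s × Equator s) → PathIn G Equator p q
          proceed (s , s≢u , t~s , es) with s Fin.≟ p | s ∈? l
          ... | yes refl | _ = trail-path (~-sym t~s ∷ t~u ∷ T) (es ∷ et ∷ el)
          ... | no  _ | yes s∈l = ⊥-elim (no-cycle t~u T (All¬⇒¬Any t∉) et el s∈l s≢u t~s)
          ... | no s≢p | no s∉l = extend-trail fuel (subst (size G <_) (≡.sym (+-suc fuel (length l))) long)
                (~-sym t~s) (t~u ∷ T) ((~⇒≢ t~s ∘ ≡.sym ∷ ¬Any⇒All¬ l s∉l) ∷ t∉ ∷ un) (es ∷ et ∷ el) s≢p

      equator-path : PathIn G Equator p q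
      equator-path with r Fin.≟ p
      ... | yes refl = step (a~p , b~p) (~-sym q~r) (here (a~q , b~q))
      ... | no  r≢p  = extend-trail (size G) {r} {q} {q ∷ []} (subst (size G <_) (+-comm 1 (size G)) ≤-refl)
              (~-sym q~r) [ q ] ((~⇒≢ q~r ∘ ≡.sym ∷ []) ∷ [] ∷ []) ((a~r , b~r) ∷ (a~q , b~q) ∷ []) r≢p

    -- Loop erasure makes the path simple, so each inner vertex has its predecessor and successor as
    -- distinct neighbours. An equatorial vertex off the path would create a K₅ minor.
    equator-path⇒closed : PathIn G Equator p q → Closed
    equator-path⇒closed π v ev with loop-erase π
    ... | l , T , un , el with v Fin.≟ p | v Fin.≟ q | v ∈? l
    ...   | yes v≡p | _ | _ = inj₁ v≡p
    ...   | no _ | yes v≡q | _ = inj₂ (inj₁ v≡q)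
    ...   | no v≢p | no v≢q | yes v∈l = inj₂ (inj₂ (two-neighbours T un el v∈l v≢p v≢q))
    ...   | no v≢p | no v≢q | no v∉l = ⊥-elim (outside T un el v∉l)
      where
      outside : ∀ {l} → Trail p q l → Unique l → All Equator l → v ∉ l → ⊥
      outside [ _ ] = contradiction refl p≢q
      -- The cycle has the three arcs `p`, the rest `l` of the path, and `x` with `z`, which close
      -- it up from `q` to `p`. The poles form the other two branch sets, joined through `v`.
      outside (_∷_ {v = u} {l = l} p~u T) (p∉ ∷ _) (ep ∷ el) v∉ = minor-free (branch-sets
          ((a ∷ v ∷ []) ∷ (b ∷ []) ∷ (p ∷ []) ∷ l ∷ (x ∷ z ∷ []) ∷ [])
          ((_ , _ , proj₁ ev ∷ [ v ]) ∷ (_ , _ , [ b ]) ∷ (_ , _ , [ p ]) ∷ (_ , _ , T) ∷ (_ , _ , x~z ∷ [ z ]) ∷ [])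
          ( ( ((λ { (here refl , here eq) → a≢b eq ; (there (here refl) , here refl) → b∉ ev })
              , v , b , there (here refl) , here refl , ~-sym (proj₂ ev))
            ∷ ((λ { (here refl , here refl) → a∉ ep ; (there (here refl) , here refl) → v∉ (here refl) })
              , a , p , here refl , here refl , a~p)
            ∷ ((λ { (here refl , a∈l) → a∉ (All.lookup el a∈l) ; (there (here refl) , v∈l) → v∉ (there v∈l) })
              , a , q , here refl , trail-last T , a~q)
            ∷ ((λ { (here refl , here eq) → ~⇒≢ a~x eq ; (here refl , there (here eq)) → a≢z eq
                  ; (there (here refl) , here refl) → x∉ ev ; (there (here refl) , there (here refl)) → z∉ ev })
              , a , x , here refl , here refl , a~x)
            ∷ [])
          ∷ ( (apart (b∉ ∷ []) (ep ∷ []) , b , p , here refl , here refl , b~p)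
            ∷ (apart (b∉ ∷ []) el , b , q , here refl , trail-last T , b~q)
            ∷ ((λ { (here refl , here eq) → x≢b (≡.sym eq) ; (here refl , there (here eq)) → ~⇒≢ b~z eq })
              , b , z , here refl , there (here refl) , b~z)
            ∷ [])
          ∷ ( ((λ { (here refl , p∈l) → All.lookup p∉ p∈l refl }) , p , u , here refl , trail-first T , p~u)
            ∷ (apart′ (ep ∷ []) xz , p , z , here refl , there (here refl) , ~-sym z~p)
            ∷ [])
          ∷ ( (apart′ el xz , q , x , trail-last T , here refl , ~-sym x~q) ∷ [])
          ∷ [] ∷ []))
        where
        xz = x∉ ∷ z∉ ∷ []

-- Preservation under homomorphisms

module _ {A B : Graph} (h : Hom A B) where

  map-K₄ : K₄ A → K₄ B
  map-K₄ (k₄ e₁ e₂ e₃ e₄ e₅ e₆) = k₄ (m e₁) (m e₂) (m e₃) (m e₄) (m e₅) (m e₆)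
    where
    m : ∀ {u v} → adj A u v ≡ true → adj B (proj₁ h u) (proj₁ h v) ≡ true
    m = proj₂ h _ _

  map-frame : Frame A → Frame B
  map-frame F = record
    { a~x = m a~x ; a~y = m a~y ; x~y = m x~y ; x~z = m x~z ; y~z = m y~z ; a~p = m a~p ; y~p = m y~p
    ; z~p = m z~p ; b~z = m b~z ; b~p = m b~p ; b~w = m b~w ; x~w = m x~w ; z~w = m z~w ; a~q = m a~q
    ; b~q = m b~q ; x~q = m x~q ; w~q = m w~q ; a~r = m a~r ; b~r = m b~r ; q~r = m q~r }
    where
    open Frame F
    m : ∀ {u v} → adj A u v ≡ true → adj B (proj₁ h u) (proj₁ h v) ≡ true
    m = proj₂ h _ _

  map-path : ∀ {P Q} → (∀ {v} → P v → Q (proj₁ h v)) → ∀ {u v} → PathIn A P u v → PathIn B Q (proj₁ h u) (proj₁ h v)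
  map-path f (here p)     = here (f p)
  map-path f (step p e π) = step (f p) (proj₂ h _ _ e) (map-path f π)

  -- `Closed` is universal and demands distinct neighbours, so it is not mapped directly: it is
  -- traded for a path on the equator, which is mapped and traded back.
  closed-preserved : K5MinorFree A → K5MinorFree B → ¬ K₄ B →
                     (F : Frame A) → Frame.Closed F → Frame.Closed (map-frame F)
  closed-preserved A-free B-free no-K₄ F closed =
    equator-path⇒closed B B-free no-K₄ (map-frame F)
      (map-path (λ (e₁ , e₂) → proj₂ h _ _ e₁ , proj₂ h _ _ e₂)
        (equator-path A A-free (no-K₄ ∘ map-K₄) F closed))

-- The sentence

anyFin⁺ : ∀ {n} {f : Fin n → Bool} i → T (f i) → T (anyFin f)
anyFin⁺ {f = f} zero    t = from T-∨ (inj₁ t)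
anyFin⁺ {f = f} (suc i) t = from (T-∨ {f zero}) (inj₂ (anyFin⁺ i t))

anyFin⁻ : ∀ {n} {f : Fin n → Bool} → T (anyFin f) → ∃ λ i → T (f i)
anyFin⁻ {suc n} {f} t with to (T-∨ {f zero}) t
... | inj₁ t₀ = zero , t₀
... | inj₂ ts = let i , tᵢ = anyFin⁻ ts in suc i , tᵢ

allFin⁺ : ∀ {n} {f : Fin n → Bool} → (∀ i → T (f i)) → T (allFin f)
allFin⁺ {zero}  t = tt
allFin⁺ {suc n} t = from T-∧ (t zero , allFin⁺ (t ∘ suc))

allFin⁻ : ∀ {n} {f : Fin n → Bool} → T (allFin f) → ∀ i → T (f i)
allFin⁻ t zero    = proj₁ (to T-∧ t)
allFin⁻ {f = f} t (suc i) = allFin⁻ (proj₂ (to (T-∧ {f zero}) t)) i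

Sat : (G : Graph) → ∀ {k} → Formula k → (Fin k → Fin (size G)) → Set
Sat G ⊤'       ρ = ⊤
Sat G ⊥'       ρ = ⊥
Sat G (x ≐ y)  ρ = ρ x ≡ ρ y
Sat G (E x y)  ρ = adj G (ρ x) (ρ y) ≡ true
Sat G (¬' φ)   ρ = ¬ Sat G φ ρ
Sat G (φ ∧' ψ) ρ = Sat G φ ρ × Sat G ψ ρ
Sat G (φ ∨' ψ) ρ = Sat G φ ρ ⊎ Sat G ψ ρ
Sat G (∃' φ)   ρ = ∃ λ v → Sat G φ (extend v ρ)
Sat G (∀' φ)   ρ = ∀ v → Sat G φ (extend v ρ)

module _ (G : Graph) where

  mutual
    eval⁺ : ∀ {k} (φ : Formula k) {ρ} → Sat G φ ρ → T (eval G φ ρ)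
    eval⁺ ⊤'       s = tt
    eval⁺ (x ≐ y)  s = fromWitness s
    eval⁺ (E x y)  s = from T-≡ s
    eval⁺ (¬' φ) {ρ} s with eval G φ ρ in eq
    ... | false = tt
    ... | true  = s (eval⁻ φ (from T-≡ eq))
    eval⁺ (φ ∧' ψ) (s , t) = from T-∧ (eval⁺ φ s , eval⁺ ψ t)
    eval⁺ (φ ∨' ψ) s = from T-∨ (Sum.map (eval⁺ φ) (eval⁺ ψ) s)
    eval⁺ (∃' φ)   (v , s) = anyFin⁺ v (eval⁺ φ s)
    eval⁺ (∀' φ)   s = allFin⁺ λ v → eval⁺ φ (s v)

    eval⁻ : ∀ {k} (φ : Formula k) {ρ} → T (eval G φ ρ) → Sat G φ ρ
    eval⁻ ⊤'       t = tt
    eval⁻ (x ≐ y)  t = toWitness t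
    eval⁻ (E x y)  t = to T-≡ t
    eval⁻ (¬' φ) {ρ} t s with eval G φ ρ in eq
    ... | false = subst T eq (eval⁺ φ s)
    eval⁻ (φ ∧' ψ) {ρ} t = let t₁ , t₂ = to (T-∧ {eval G φ ρ}) t in eval⁻ φ t₁ , eval⁻ ψ t₂
    eval⁻ (φ ∨' ψ) {ρ} t = Sum.map (eval⁻ φ) (eval⁻ ψ) (to (T-∨ {eval G φ ρ}) t)
    eval⁻ (∃' φ)   t = let v , s = anyFin⁻ t in v , eval⁻ φ s
    eval⁻ (∀' φ)   t v = eval⁻ φ (allFin⁻ t v)

  -- The empty assignment in _⊨_ is an absurd lambda, which can only be referred
  -- to by unification.
  models⁺ : (φ : Sentence) → (∀ ρ → Sat G φ ρ) → G ⊨ φ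
  models⁺ φ s = eval⁺ φ (s _)

  models⁻ : (φ : Sentence) → G ⊨ φ → ∃ λ ρ → Sat G φ ρ
  models⁻ φ t = _ , eval⁻ φ t

infixr 6 _⋀_
infixr 5 _⋁_
_⋀_ _⋁_ : ∀ {k} → Formula k → Formula k → Formula k
_⋀_ = _∧'_
_⋁_ = _∨'_

K₄-formula : Sentence
K₄-formula = ∃' (∃' (E 1F 0F ⋀
  ∃' (E 2F 0F ⋀ E 1F 0F ⋀
  ∃' (E 3F 0F ⋀ E 2F 0F ⋀ E 1F 0F))))

-- The free variables are r q w b p z y x a, in the order of their indices.
closed-formula : Formula 9
closed-formula = ∀' ((¬' (E 9F 0F ⋀ E 4F 0F)) ⋁ (0F ≐ 5F) ⋁ (0F ≐ 2F) ⋁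
  ∃' (∃' (E 2F 1F ⋀ E 2F 0F ⋀ E (suc (suc 9F)) 1F ⋀ E 6F 1F ⋀
    E (suc (suc 9F)) 0F ⋀ E 6F 0F ⋀ (¬' (1F ≐ 0F)))))

-- The quantifiers bind a x y z p b w q r in this order. Each edge is tested as
-- early as possible, which keeps the evaluation in a concrete graph fast.
frame-formula : Sentence
frame-formula = ∃' (∃' (E 1F 0F ⋀
  ∃' (E 2F 0F ⋀ E 1F 0F ⋀
  ∃' (E 2F 0F ⋀ E 1F 0F ⋀
  ∃' (E 4F 0F ⋀ E 2F 0F ⋀ E 1F 0F ⋀
  ∃' (E 0F 2F ⋀ E 0F 1F ⋀
  ∃' (E 1F 0F ⋀ E 5F 0F ⋀ E 3F 0F ⋀
  ∃' (E 7F 0F ⋀ E 2F 0F ⋀ E 6F 0F ⋀ E 1F 0F ⋀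
  ∃' (E 8F 0F ⋀ E 3F 0F ⋀ E 1F 0F ⋀ closed-formula)))))))))

sentence : Sentence
sentence = K₄-formula ⋁ frame-formula

module _ (G : Graph) {ρ : Fin 0 → Fin (size G)} where

  K₄⁺ : K₄ G → Sat G K₄-formula ρ
  K₄⁺ (k₄ e₁₂ e₁₃ e₁₄ e₂₃ e₂₄ e₃₄) = _ , _ , e₁₂ , _ , e₁₃ , e₂₃ , _ , e₁₄ , e₂₄ , e₃₄

  K₄⁻ : Sat G K₄-formula ρ → K₄ G
  K₄⁻ (_ , _ , e₁₂ , _ , e₁₃ , e₂₃ , _ , e₁₄ , e₂₄ , e₃₄) = k₄ e₁₂ e₁₃ e₁₄ e₂₃ e₂₄ e₃₄

  frame⁺ : (F : Frame G) → Frame.Closed F → Sat G frame-formula ρ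
  frame⁺ F closed =
    a , x , a~x , y , a~y , x~y , z , x~z , y~z , p , a~p , y~p , z~p , b , b~z , b~p ,
    w , b~w , x~w , z~w , q , a~q , b~q , x~q , w~q , r , a~r , b~r , q~r , rim
    where
    open Frame F
    rim : Sat G closed-formula (extend r (extend q (extend w (extend b (extend p
            (extend z (extend y (extend x (extend a ρ)))))))))
    rim v with adj G a v ≟ᵇ true | adj G b v ≟ᵇ true
    ... | no  a≁v | _       = inj₁ (a≁v ∘ proj₁)
    ... | yes _   | no b≁v  = inj₁ (b≁v ∘ proj₂)
    ... | yes a~v | yes b~v with closed v (a~v , b~v)
    ...   | inj₁ v≡p        = inj₂ (inj₁ v≡p)
    ...   | inj₂ (inj₁ v≡q) = inj₂ (inj₂ (inj₁ v≡q))
    ...   | inj₂ (inj₂ (s , t , s≢t , v~s , v~t , (a~s , b~s) , (a~t , b~t))) =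
            inj₂ (inj₂ (inj₂ (s , t , v~s , v~t , a~s , b~s , a~t , b~t , s≢t)))

  frame⁻ : Sat G frame-formula ρ → Σ (Frame G) Frame.Closed
  frame⁻ (a , x , a~x , y , a~y , x~y , z , x~z , y~z , p , a~p , y~p , z~p , b , b~z , b~p ,
          w , b~w , x~w , z~w , q , a~q , b~q , x~q , w~q , r , a~r , b~r , q~r , rim) = F , closed
    where
    F : Frame G
    F = record
      { a~x = a~x ; a~y = a~y ; x~y = x~y ; x~z = x~z ; y~z = y~z ; a~p = a~p ; y~p = y~p
      ; z~p = z~p ; b~z = b~z ; b~p = b~p ; b~w = b~w ; x~w = x~w ; z~w = z~w ; a~q = a~q
      ; b~q = b~q ; x~q = x~q ; w~q = w~q ; a~r = a~r ; b~r = b~r ; q~r = q~r }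
    closed : Frame.Closed F
    closed v ev with rim v
    ... | inj₁ v∉                = contradiction ev v∉
    ... | inj₂ (inj₁ v≡p)        = inj₁ v≡p
    ... | inj₂ (inj₂ (inj₁ v≡q)) = inj₂ (inj₁ v≡q)
    ... | inj₂ (inj₂ (inj₂ (s , t , v~s , v~t , a~s , b~s , a~t , b~t , s≢t))) =
          inj₂ (inj₂ (s , t , s≢t , v~s , v~t , (a~s , b~s) , (a~t , b~t)))

Property : Graph → Set
Property G = K₄ G ⊎ Σ (Frame G) Frame.Closed

sentence⁺ : ∀ G → Property G → G ⊨ sentence
sentence⁺ G P = models⁺ G sentence λ ρ → Sum.map (K₄⁺ G {ρ}) (λ (F , closed) → frame⁺ G {ρ} F closed) P

sentence⁻ : ∀ G → G ⊨ sentence → Property G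
sentence⁻ G t = let ρ , s = models⁻ G sentence t in Sum.map (K₄⁻ G {ρ}) (frame⁻ G {ρ}) s

-- Evaluating the formula decides this, which permits the case distinction on the target graph
-- below.
K₄? : ∀ G → Dec (K₄ G)
K₄? G = map′ (λ t → let ρ , s = models⁻ G K₄-formula t in K₄⁻ G {ρ} s)
             (λ k → models⁺ G K₄-formula λ ρ → K₄⁺ G {ρ} k) (T? _)

property-preserved : ∀ {A B} → K5MinorFree A → K5MinorFree B → Hom A B → Property A → Property B
property-preserved A-free B-free h (inj₁ k) = inj₁ (map-K₄ h k)
property-preserved {B = B} A-free B-free h (inj₂ (F , closed)) with K₄? B
... | yes k = inj₁ k
... | no ¬k = inj₂ (map-frame h F , closed-preserved h A-free B-free ¬k F closed)

sentence-preserved : PreservedByHom K5MinorFree sentence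
sentence-preserved A B A-free B-free h = sentence⁺ B ∘ property-preserved A-free B-free h ∘ sentence⁻ A

-- Existential-positive sentences and folding

-- Counts all quantifiers, in both branches of a disjunction too; only an upper bound on the number
-- of witnesses is needed.
width : ∀ {k} {φ : Formula k} → ExPos φ → ℕ
width ep-⊤       = 0
width ep-⊥       = 0
width (ep-≐ _ _) = 0
width (ep-E _ _) = 0
width (ep-∧ φ ψ) = width φ + width ψ
width (ep-∨ φ ψ) = width φ + width ψ
width (ep-∃ φ)   = suc (width φ)

HomOn : (G H : Graph) → (Fin (size G) → Set) → (Fin (size G) → Fin (size H)) → Set
HomOn G H P h = ∀ {u v} → P u → P v → adj G u v ≡ true → adj H (h u) (h v) ≡ true

-- `L` collects the witnesses of the quantifiers. Truth depends on equalities and edges among these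
-- and the assigned vertices only, so a map need respect edges just on a set `P` containing them.
-- Pointwise equality of assignments avoids function extensionality.
support : ∀ {k} {φ : Formula k} (ep : ExPos φ) {G ρ} → Sat G φ ρ →
          ∃ λ L → length L ≤ width ep ×
          ∀ {H h P} → HomOn G H P h → (∀ i → P (ρ i)) → (∀ {v} → v ∈ L → P v) →
          ∀ {ρ′} → (∀ i → ρ′ i ≡ h (ρ i)) → Sat H φ ρ′
support ep-⊤ s = [] , z≤n , λ _ _ _ _ → tt
support (ep-≐ x y) s = [] , z≤n , λ {_} {h} _ _ _ eq → ≡.trans (eq x) (≡.trans (cong h s) (≡.sym (eq y)))
support (ep-E x y) s = [] , z≤n , λ {H} hom Pρ _ eq → ≡.trans (cong₂ (adj H) (eq x) (eq y)) (hom (Pρ x) (Pρ y) s)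
support (ep-∧ φ ψ) (s , t) =
  let L , L≤ , f = support φ s
      K , K≤ , g = support ψ t
  in L ++ K , ≤-trans (≤-reflexive (length-++ L)) (+-mono-≤ L≤ K≤) ,
     λ hom Pρ PL eq → f hom Pρ (PL ∘ ∈-++⁺ˡ) eq , g hom Pρ (PL ∘ ∈-++⁺ʳ L) eq
support (ep-∨ φ ψ) (inj₁ s) =
  let L , L≤ , f = support φ s
  in L , ≤-trans L≤ (m≤m+n _ _) , λ hom Pρ PL eq → inj₁ (f hom Pρ PL eq)
support (ep-∨ φ ψ) (inj₂ t) =
  let L , L≤ , f = support ψ t
  in L , ≤-trans L≤ (m≤n+m _ (width φ)) , λ hom Pρ PL eq → inj₂ (f hom Pρ PL eq)
support (ep-∃ φ) (v , s) =
  let L , L≤ , f = support φ s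
  in v ∷ L , s≤s L≤ , λ {_} {h} hom Pρ PL eq → h v , f hom
       (λ { zero → PL (here refl) ; (suc i) → Pρ i }) (PL ∘ there) (λ { zero → refl ; (suc i) → eq i })

-- The belts as finite graphs satisfying the sentence

edge-irrefl : ∀ {n} {S : Fin n → Fin n → Bool} → (∀ i → S i i ≡ false) → ∀ v → edge S v v ≡ false
edge-irrefl irr 𝕒 = refl
edge-irrefl irr 𝕓 = refl
edge-irrefl irr 𝕩 = refl
edge-irrefl irr 𝕪 = refl
edge-irrefl irr 𝕫 = refl
edge-irrefl irr 𝕨 = refl
edge-irrefl irr (𝕦 i) = cong₂ _∨_ (irr i) (irr i)

Γ : ∀ {n} (S : Fin n → Fin n → Bool) → (∀ i → S i i ≡ false) → Graph
Γ {n} S irr = record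
  { size   = 6 + n
  ; adj    = λ i j → edge S (splitAt 6 i) (splitAt 6 j)
  ; sym    = λ i j → edge-sym S (splitAt 6 i) (splitAt 6 j)
  ; irrefl = λ i → edge-irrefl irr (splitAt 6 i)
  }

Γ-free : ∀ {n} {S : Fin n → Fin n → Bool} {irr} → ¬ Model (edge S) → K5MinorFree (Γ S irr)
Γ-free {n} none M = none (transfer (fromK5Model M) (splitAt 6) (β ∘ join 6 n)
  (λ {v} → ≡.trans (cong β (join-splitAt 6 n v)))
  (λ {w} bw → join 6 n w , splitAt-join 6 n w , bw) inj₂)
  where open K5Model M

next-irrefl : ∀ {n} (i : Fin n) → next i i ≡ false
next-irrefl zero    = refl
next-irrefl (suc i) = next-irrefl i

belt : ℕ → Graph
belt k = Γ (next {4 + k}) next-irrefl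

belt-free : ∀ k → K5MinorFree (belt k)
belt-free k = Γ-free (no-model-family k)

isLast-fromℕ : ∀ n → isLast (fromℕ n) ≡ true
isLast-fromℕ zero    = refl
isLast-fromℕ (suc n) = isLast-fromℕ n

next-suc : ∀ {n} (i : Fin n) → next (inject₁ i) (suc i) ≡ true
next-suc zero    = refl
next-suc (suc i) = next-suc i

interior : ∀ {n} (i : Fin (suc n)) → i ≡ zero ⊎ i ≡ fromℕ n ⊎
           ∃ λ s → ∃ λ t → s ≢ t × next s i ≡ true × next i t ≡ true
interior zero = inj₁ refl
interior {suc n} (suc i) with interior i
interior {suc zero}    (suc i) | inj₁ refl = inj₂ (inj₁ refl)
interior {suc (suc n)} (suc i) | inj₁ refl = inj₂ (inj₂ (0F , 2F , (λ ()) , refl , refl))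
... | inj₂ (inj₁ refl) = inj₂ (inj₁ refl)
... | inj₂ (inj₂ (s , t , s≢t , e , e′)) = inj₂ (inj₂ (suc s , suc t , s≢t ∘ suc-injective , e , e′))

module _ (k : ℕ) where

  belt-frame : Frame (belt k)
  belt-frame = record
    { a = 0F ; b = 1F ; x = 2F ; y = 3F ; z = 4F ; w = 5F
    ; p = 6 ↑ʳ zero ; q = 6 ↑ʳ fromℕ (3 + k) ; r = 6 ↑ʳ inject₁ (fromℕ (2 + k))
    ; a~x = refl ; a~y = refl ; x~y = refl ; x~z = refl ; y~z = refl ; a~p = refl ; y~p = refl
    ; z~p = refl ; b~z = refl ; b~p = refl ; b~w = refl ; x~w = refl ; z~w = refl ; a~q = refl
    ; b~q = refl ; x~q = cong (_∨ false) (isLast-fromℕ (3 + k)) ; w~q = cong (_∨ false) (isLast-fromℕ (3 + k))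
    ; a~r = refl ; b~r = refl
    ; q~r = ≡.trans (cong (next (fromℕ (3 + k)) (inject₁ (fromℕ (2 + k))) ∨_) (next-suc (fromℕ (2 + k))))
                    (∨-zeroʳ _)
    }

  belt-closed : Frame.Closed belt-frame
  belt-closed 0F (() , _)
  belt-closed 1F (() , _)
  belt-closed 2F (_ , ())
  belt-closed 3F (_ , ())
  belt-closed 4F (() , _)
  belt-closed 5F (() , _)
  belt-closed (suc (suc (suc (suc (suc (suc i)))))) _ with interior i
  ... | inj₁ refl        = inj₁ refl
  ... | inj₂ (inj₁ refl) = inj₂ (inj₁ refl)
  ... | inj₂ (inj₂ (s , t , s≢t , s→i , i→t)) = inj₂ (inj₂ (6 ↑ʳ s , 6 ↑ʳ t , s≢t ∘ ↑ʳ-injective 6 s t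
        , ≡.trans (cong (next i s ∨_) s→i) (∨-zeroʳ _) , cong (_∨ next t i) i→t , (refl , refl) , (refl , refl)))

  belt-models : belt k ⊨ sentence
  belt-models = sentence⁺ (belt k) (inj₂ (belt-frame , belt-closed))

-- The broken belt and folding onto it

cut : Fin 4 → Fin 4 → Bool
cut 0F 1F = true
cut 2F 3F = true
cut _  _  = false

cut-irrefl : ∀ i → cut i i ≡ false
cut-irrefl 0F = refl
cut-irrefl 1F = refl
cut-irrefl 2F = refl
cut-irrefl 3F = refl

cut⇒next : ∀ {i j} → T (cut i j) → T (next i j)
cut⇒next {0F} {1F} _ = tt
cut⇒next {2F} {3F} _ = tt

broken : Graph
broken = Γ cut cut-irrefl

map₂-id : ∀ {n} (v : Vertex n) → map₂ (λ i → i) v ≡ v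
map₂-id (inj₁ _) = refl
map₂-id (inj₂ _) = refl

-- The broken belt is a subgraph of the belt with four path vertices.
broken-free : K5MinorFree broken
broken-free = Γ-free λ M → no-model-family 0 (transfer M (map₂ (λ i → i)) (Model.β M)
  (λ {v} → ≡.trans (cong (Model.β M) (map₂-id v))) (λ {v} bv → v , map₂-id v , bv)
  (λ {s} {t} e → inj₂ (edge-map {S = cut} (λ _ → ⊤) (λ i → i) (λ s t → T (edge next s t))
     (λ {s} {t} → edge-symᵀ next {s} {t}) (λ e → e) (λ _ e → e) (λ _ e → e)
     (λ {i} {j} _ _ e → from T-∨ (inj₁ (cut⇒next {i} {j} e)))
     {s} {t} (λ _ → tt) (λ _ → tt) e)))

refuted : ∀ {G} (φ : Sentence) → (∀ ρ → eval G φ ρ ≡ false) → ¬ G ⊨ φ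
refuted φ eq t = subst T (eq _) t

broken-fails : ¬ broken ⊨ sentence
-- This `refl` evaluates the sentence over all choices of vertices in the ten-vertex graph.
broken-fails = refuted {broken} sentence λ _ → refl

left right : Bool → Fin 4
left false = 0F
left true  = 1F
right false = 3F
right true  = 2F

odd : ℕ → Bool
odd zero    = false
odd (suc n) = not (odd n)

-- The parity is that of the distance to the last vertex, so that the last vertex lands on `3F`
-- whatever the length of the path.
from-end : ∀ {n} → Fin n → Fin 4
from-end {suc n} zero    = right (odd n)
from-end         (suc j) = from-end j

-- Removing the i-th vertex of a path leaves two paths, each of which folds onto
-- one of the two edges of the cut path.
fold : ∀ {n} → Bool → Fin n → Fin n → Fin 4
-- A default value for the removed vertex itself.
fold b zero    zero    = 0F
fold b zero    (suc j) = from-end j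
fold b (suc i) zero    = left b
fold b (suc i) (suc j) = fold (not b) i j

fold-first : ∀ {n} {i j : Fin n} → j ≢ i → T (isFirst j) → T (isFirst (fold false i j))
fold-first {i = zero}  {zero} j≢i _ = contradiction refl j≢i
fold-first {i = suc i} {zero} _   _ = tt

from-end-last : ∀ {n} (j : Fin n) → T (isLast j) → T (isLast (from-end j))
from-end-last {suc zero} zero    _ = tt
from-end-last            (suc j) e = from-end-last j e

fold-last : ∀ {n} b {i j : Fin n} → j ≢ i → T (isLast j) → T (isLast (fold b i j))
fold-last b {zero}        {zero}  j≢i _ = contradiction refl j≢i
fold-last b {zero}        {suc j} _   e = from-end-last j e
fold-last b {suc zero}    {zero}  _   ()
fold-last b {suc (suc i)} {zero}  _   ()
fold-last b {suc i}       {suc j} j≢i e = fold-last (not b) (j≢i ∘ cong suc) e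

from-end-next : ∀ {n} {i j : Fin n} → T (next i j) → T (edge cut (𝕦 (from-end i)) (𝕦 (from-end j)))
from-end-next {suc (suc n)} {zero} {suc zero} _ with odd n
... | false = tt
... | true  = tt
from-end-next {i = suc i} {suc j} e = from-end-next {i = i} {j} e

fold-next : ∀ {n} b {i s t : Fin n} → s ≢ i → t ≢ i → T (next s t) →
            T (edge cut (𝕦 (fold b i s)) (𝕦 (fold b i t)))
fold-next b {zero}  {zero}  s≢i _ _ = contradiction refl s≢i
fold-next b {zero}  {suc s} {suc t} _ _ e = from-end-next {i = s} {t} e
fold-next b {suc zero} {zero} {suc zero} _ t≢i _ = contradiction refl t≢i
fold-next false {suc (suc i)} {zero} {suc zero} _ _ _ = tt
fold-next true  {suc (suc i)} {zero} {suc zero} _ _ _ = tt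
fold-next b {suc i} {suc s} {suc t} s≢i t≢i e = fold-next (not b) {i} {s} {t} (s≢i ∘ cong suc) (t≢i ∘ cong suc) e

belt-fold : ∀ {k} → Fin (4 + k) → Fin (10 + k) → Fin 10
belt-fold i = join 6 4 ∘ map₂ (fold false i) ∘ splitAt 6

belt-fold-hom : ∀ k i → HomOn (belt k) broken (_≢ 6 ↑ʳ i) (belt-fold {k} i)
belt-fold-hom k i {u} {v} u≢ v≢ e = ≡.trans
  (cong₂ (edge cut) (splitAt-join 6 4 (f (splitAt 6 u))) (splitAt-join 6 4 (f (splitAt 6 v))))
  (to T-≡ (edge-map (_≢ i) (fold false i) (λ s t → T (edge cut s t)) (λ {s} {t} → edge-symᵀ cut {s} {t}) (λ e → e)
    fold-first (fold-last false) (λ {s} {t} s≢ t≢ e → fold-next false {i} {s} {t} s≢ t≢ e)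
    {splitAt 6 u} {splitAt 6 v} (avoid u u≢) (avoid v v≢) (from T-≡ e)))
  where
  f = map₂ (fold false i)
  avoid : ∀ u → u ≢ 6 ↑ʳ i → ∀ {j} → splitAt 6 u ≡ 𝕦 j → j ≢ i
  avoid u u≢ eq refl = u≢ (≡.trans (≡.sym (join-splitAt 6 (4 + k) u)) (cong (join 6 (4 + k)) eq))

-- There are `4 + k` path vertices, too many to fit in `L`.
missed : ∀ {k} (L : List (Fin (10 + k))) → length L ≤ k → ∃ λ (i : Fin (4 + k)) → 6 ↑ʳ i ∉ L
missed {k} L L≤k with any? (λ i → ¬? (6 ↑ʳ i ∈? L))
  where open DecMembership (Fin._≟_ {10 + k}) using (_∈?_)
... | yes found = found
... | no  none  = contradiction (≤-trans (injection-length (6 ↑ʳ_) (λ {i} {j} → ↑ʳ-injective 6 i j) {L}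
                    (λ i → decidable-stable (6 ↑ʳ i ∈? L) (λ i∉ → none (i , i∉)))) L≤k) (<⇒≱ (m≤n+m (suc k) 3))
  where open DecMembership (Fin._≟_ {10 + k}) using (_∈?_)

-- The length of the belt is tied to `width ep`, so the witnesses leave out some path vertex; away
-- from it the fold is a homomorphism.
belt⇒broken : ∀ {ψ : Sentence} (ep : ExPos ψ) → belt (width ep) ⊨ ψ → broken ⊨ ψ
belt⇒broken {ψ} ep t with models⁻ (belt (width ep)) ψ t
... | ρ , s with support ep {belt (width ep)} s
...   | L , L≤k , f with missed L L≤k
...     | i , i∉L = models⁺ broken ψ λ ρ′ →
            f {broken} {belt-fold {width ep} i} {_≢ 6 ↑ʳ i}
              (λ {u} {v} → belt-fold-hom (width ep) i {u} {v}) (λ ()) (λ { v∈L refl → i∉L v∈L }) (λ ())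

not-existential-positive : ∀ {φ ψ} → (∀ k → belt k ⊨ φ) → ¬ broken ⊨ φ → ExPos ψ → ¬ EquivalentOn K5MinorFree φ ψ
not-existential-positive belts fails ep equivalent =
  fails (from (equivalent broken broken-free)
    (belt⇒broken ep (to (equivalent (belt (width ep)) (belt-free (width ep))) (belts (width ep)))))

theorem5p9 : ¬ HPP K5MinorFree
theorem5p9 hpp =
  let _ , ep , equivalent = hpp sentence sentence-preserved
  in not-existential-positive {sentence} belt-models broken-fails ep equivalent
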